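{- For integers $m,n>2$ and $l>0$, \begin{align*} \zeta_{H_{m,n,l}}(u)^{ -1}=&-4u^{2m+2n+2l}+u^{2m+2n}+4u^{2m+n+2l}+4u^{m+2n+2l}-2u^{2m+n}-2u^{m+2n}\\ &-4u^{m+n+2l}+4u^{m+n}+u^{2n}+u^{2m}-2u^{n}-2u^{m}+1. \end{align*}
   Context: For $m,n>2$ and $l>0$, the handcuff graph $H_{m,n,l}$ consists of two vertex-disjoint cycles $C_m$ and $C_n$ together with a path of $l$ edges joining a vertex of $C_m$ to a vertex of $C_n$, internally disjoint from both cycles. For a finite connected graph $G$ with vertex set $V$, edge set $E$ and no vertex of degree $1$, let $r=|E|-|V|+1$, $\mathcal{A}$ the adjacency matrix, $\mathcal{Q}=D-I$ with $D$ the diagonal degree matrix; the reciprocal Ihara zeta function is $\zeta_G(u)^{ -1}=(1-u^2)^{r-1}\det(I-\mathcal{A}u+\mathcal{Q}u^2)$. -}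

module Defs where

open import Algebra.Bundles using (CommutativeRing)
open import Data.Bool.Base using (if_then_else_)
open import Data.Fin.Base as Fin using (Fin; zero; suc; toℕ; fromℕ<; punchIn)
open import Data.Fin.Properties as Fin using (toℕ-injective; toℕ-fromℕ<; toℕ<n)
open import Data.List.Base using (List; []; _∷_; length; filter; allFin; cartesianProduct)
open import Data.List.Membership.Propositional using (_∈_)
open import Data.List.Membership.Propositional.Properties using (∈-filter⁺; ∈-allFin)
open import Data.List.Relation.Unary.Any using (here)
open import Data.Nat.Base using (ℕ; zero; suc; _+_; _∸_; _≤_; _<_; _>_; z≤n; s≤s; s≤s⁻¹)
open import Data.Nat.Properties as ℕ using (_≟_; _≤?_; _<?_)
open import Data.Product.Base using (_×_; _,_)
open import Data.Sum.Base using (_⊎_; inj₁; inj₂)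
open import Function.Base using (_∘_)
open import Relation.Binary.Construct.Closure.ReflexiveTransitive using (Star; ε; _◅◅_; _◅_; reverse)
open import Relation.Binary.Core using (Rel)
open import Relation.Binary.Definitions using (Decidable; Symmetric)
open import Relation.Binary.PropositionalEquality using (_≡_; _≢_; refl; sym; trans; cong; subst)
open import Relation.Nullary.Decidable using (yes; no; does; _×-dec_; _⊎-dec_)
open import Relation.Nullary.Negation using (¬_)
import Algebra.Properties.Semiring.Exp as Exp
import Algebra.Properties.Semiring.Mult as Mult
import Algebra.Properties.Semiring.Sum as Sum
import Level

record Graph (N : ℕ) : Set₁ where
  infix 4 _~_ _~?_
  field
    _~_      : Rel (Fin N) Level.zero
    _~?_     : Decidable _~_
    ~-sym    : Symmetric _~_
    ~-irrefl : ∀ {i} → ¬ (i ~ i)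

  degree : Fin N → ℕ
  degree i = length (filter (i ~?_) (allFin N))

  -- Each edge is counted once, as the pair of its endpoints in increasing order.
  edges : List (Fin N × Fin N)
  edges = filter (λ (i , j) → (i Fin.<? j) ×-dec (i ~? j))
                 (cartesianProduct (allFin N) (allFin N))

  Connected : Set
  Connected = ∀ i j → Star _~_ i j

  -- r = |E| - |V| + 1; there is no truncation for a connected graph.
  rank : ℕ
  rank = length edges + 1 ∸ N

record LeaflessConnectedGraph (N : ℕ) : Set₁ where
  field
    graph     : Graph N
    connected : Graph.Connected graph
    leafless  : ∀ i → Graph.degree graph i ≢ 1

module _ {c ℓ} (R : CommutativeRing c ℓ) where
  open CommutativeRing R using (Carrier; semiring; 0#; 1#; -_; _-_) renaming (_+_ to _⊕_; _*_ to _⊛_)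
  open Exp semiring using (_^_)
  open Mult semiring using () renaming (_×_ to _·_)
  open Sum semiring using (sum)

  Matrix : ℕ → Set c
  Matrix N = Fin N → Fin N → Carrier

  -- Laplace expansion along the first row.
  det : ∀ {N} → Matrix N → Carrier
  det {zero}  M = 1#
  det {suc N} M = sum λ j →
    ((- 1#) ^ toℕ j) ⊛ (M zero j ⊛ det (λ i k → M (suc i) (punchIn j k)))

  diagonal : ∀ {N} → (Fin N → Carrier) → Matrix N
  diagonal d i j = if does (i Fin.≟ j) then d i else 0#

  identity : ∀ {N} → Matrix N
  identity = diagonal λ _ → 1#

  module _ {N : ℕ} (G : Graph N) where
    open Graph G

    adjacency : Matrix N
    adjacency i j = if does (i ~? j) then 1# else 0#

    𝒬 : Matrix N
    𝒬 i j = diagonal (λ k → degree k · 1#) i j - identity i j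

  -- The exponent r - 1 is truncated only for the one-vertex graph, where r = 0.
  ζ⁻¹ : ∀ {N} → LeaflessConnectedGraph N → Carrier → Carrier
  ζ⁻¹ G u =
    ((1# - u ^ 2) ^ (Graph.rank graph ∸ 1)) ⊛
    det (λ i j → (identity i j - adjacency graph i j ⊛ u) ⊕ 𝒬 graph i j ⊛ (u ^ 2))
    where open LeaflessConnectedGraph G

-- The path a, a + 1, …, a + k with k edges.
PathEdge : (a k : ℕ) → Rel ℕ Level.zero
PathEdge a k x y = a ≤ x × x < a + k × y ≡ suc x

-- The cycle on the k vertices a, a + 1, …, a + (k - 1).
CycleEdge : (a k : ℕ) → Rel ℕ Level.zero
CycleEdge a k x y = PathEdge a (k ∸ 1) x y ⊎ (x ≡ a + (k ∸ 1) × y ≡ a)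

-- C_m is on 0, …, m - 1; the joining path runs from m - 1 to m - 1 + l; and C_n is
-- on m - 1 + l, …, m - 1 + l + (n - 1).
HandcuffEdge : (m n l : ℕ) → Rel ℕ Level.zero
HandcuffEdge m n l x y =
  CycleEdge 0 m x y ⊎ PathEdge (m ∸ 1) l x y ⊎ CycleEdge (m ∸ 1 + l) n x y

pathEdge? : ∀ a k → Decidable (PathEdge a k)
pathEdge? a k x y = (a ≤? x) ×-dec (x <? a + k) ×-dec (y ≟ suc x)

cycleEdge? : ∀ a k → Decidable (CycleEdge a k)
cycleEdge? a k x y = pathEdge? a (k ∸ 1) x y ⊎-dec ((x ≟ a + (k ∸ 1)) ×-dec (y ≟ a))

handcuffEdge? : ∀ m n l → Decidable (HandcuffEdge m n l)
handcuffEdge? m n l x y =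
  cycleEdge? 0 m x y ⊎-dec pathEdge? (m ∸ 1) l x y ⊎-dec cycleEdge? (m ∸ 1 + l) n x y

pathEdge-irrefl : ∀ {a k x} → ¬ PathEdge a k x x
pathEdge-irrefl (_ , _ , x≡1+x) = ℕ.1+n≢n (sym x≡1+x)

cycleEdge-irrefl : ∀ {a k x} → k > 2 → ¬ CycleEdge a k x x
cycleEdge-irrefl k>2 (inj₁ e) = pathEdge-irrefl e
cycleEdge-irrefl {a} (s≤s (s≤s _)) (inj₂ (refl , a+k≡a)) = ℕ.m+1+n≢m a a+k≡a

handcuffEdge-irrefl : ∀ {m n l x} → m > 2 → n > 2 → ¬ HandcuffEdge m n l x x
handcuffEdge-irrefl m>2 n>2 (inj₁ e)        = cycleEdge-irrefl m>2 e
handcuffEdge-irrefl m>2 n>2 (inj₂ (inj₁ e)) = pathEdge-irrefl e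
handcuffEdge-irrefl m>2 n>2 (inj₂ (inj₂ e)) = cycleEdge-irrefl n>2 e

handcuffGraph : ∀ m n l → m > 2 → n > 2 → Graph (m ∸ 1 + l + n)
handcuffGraph m n l m>2 n>2 = record
  { _~_      = λ i j → Edge (toℕ i) (toℕ j) ⊎ Edge (toℕ j) (toℕ i)
  ; _~?_     = λ i j → edge? (toℕ i) (toℕ j) ⊎-dec edge? (toℕ j) (toℕ i)
  ; ~-sym    = λ { (inj₁ e) → inj₂ e ; (inj₂ e) → inj₁ e }
  ; ~-irrefl = λ { (inj₁ e) → handcuffEdge-irrefl m>2 n>2 e
                 ; (inj₂ e) → handcuffEdge-irrefl m>2 n>2 e }
  }
  where
  Edge  = HandcuffEdge m n l
  edge? = handcuffEdge? m n l

module _ {N : ℕ} (G : Graph N) where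
  open Graph G

  Consecutive : Set
  Consecutive = ∀ i j → toℕ j ≡ suc (toℕ i) → i ~ j

  ascend : Consecutive → ∀ d i j → toℕ j ≡ d + toℕ i → Star _~_ i j
  ascend next zero    i j j≡i = subst (Star _~_ i) (toℕ-injective (sym j≡i)) ε
  ascend next (suc d) i j j≡  =
    ascend next d i k k≡ ◅◅ next k j (trans j≡ (cong suc (sym k≡))) ◅ ε
    where
    d+i<N : d + toℕ i < N
    d+i<N = ℕ.<-trans (ℕ.n<1+n _) (subst (_< N) j≡ (toℕ<n j))
    k = fromℕ< d+i<N
    k≡ : toℕ k ≡ d + toℕ i
    k≡ = toℕ-fromℕ< d+i<N

  consecutive⇒connected : Consecutive → Connected
  consecutive⇒connected next i j with ℕ.≤-total (toℕ i) (toℕ j)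
  ... | inj₁ i≤j = ascend next (toℕ j ∸ toℕ i) i j (sym (ℕ.m∸n+n≡m i≤j))
  ... | inj₂ j≤i =
    reverse ~-sym (ascend next (toℕ i ∸ toℕ j) j i (sym (ℕ.m∸n+n≡m j≤i)))

  twoNeighbours⇒degree≢1 : ∀ {i j k} → i ~ j → i ~ k → j ≢ k → degree i ≢ 1
  twoNeighbours⇒degree≢1 {i} i~j i~k j≢k =
    noSingleton (∈-filter⁺ (i ~?_) (∈-allFin _) i~j) (∈-filter⁺ (i ~?_) (∈-allFin _) i~k)
    where
    noSingleton : ∀ {xs} → _ ∈ xs → _ ∈ xs → length xs ≢ 1
    noSingleton {_ ∷ []} (here refl) (here refl) _ = j≢k refl

module _ {m n l : ℕ} (m>2 : m > 2) (n>2 : n > 2) where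
  open Graph (handcuffGraph m n l m>2 n>2)

  private
    N = m ∸ 1 + l + n

    next-edge : ∀ x → suc x < N → HandcuffEdge m n l x (suc x)
    next-edge x 1+x<N with x <? m ∸ 1 | x <? m ∸ 1 + l
    ... | yes x<m | _       = inj₁ (inj₁ (z≤n , x<m , refl))
    ... | no  x≮m | yes x<l = inj₂ (inj₁ (ℕ.≮⇒≥ x≮m , x<l , refl))
    ... | no  x≮m | no  x≮l = inj₂ (inj₂ (inj₁ (ℕ.≮⇒≥ x≮l , bound n>2 1+x<N , refl)))
      where
      bound : ∀ {n} → n > 2 → suc x < m ∸ 1 + l + n → x < m ∸ 1 + l + (n ∸ 1)
      bound {suc n} _ p = s≤s⁻¹ (subst (suc x <_) (ℕ.+-suc (m ∸ 1 + l) n) p)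

    Adjacent : Rel ℕ Level.zero
    Adjacent x y = HandcuffEdge m n l x y ⊎ HandcuffEdge m n l y x

    neighbours : ∀ {i x y z} → toℕ i ≡ x → y < N → z < N → y ≢ z →
      Adjacent x y → Adjacent x z → degree i ≢ 1
    neighbours {i} refl y<N z<N y≢z x~y x~z =
      twoNeighbours⇒degree≢1 (handcuffGraph m n l m>2 n>2)
        (subst (Adjacent (toℕ i)) (sym (toℕ-fromℕ< y<N)) x~y)
        (subst (Adjacent (toℕ i)) (sym (toℕ-fromℕ< z<N)) x~z)
        (y≢z ∘ Fin.fromℕ<-injective _ _ y<N z<N)

  handcuff-consecutive : Consecutive (handcuffGraph m n l m>2 n>2)
  handcuff-consecutive i j j≡1+i =
    inj₁ (subst (HandcuffEdge m n l (toℕ i)) (sym j≡1+i)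
                (next-edge (toℕ i) (subst (_< N) j≡1+i (toℕ<n j))))

  handcuff-leafless : ∀ i → degree i ≢ 1
  handcuff-leafless i = go (toℕ i) refl
    where
    1<m∸1 : 1 < m ∸ 1
    1<m∸1 = ℕ.∸-monoˡ-≤ 1 m>2

    1<n∸1 : 1 < n ∸ 1
    1<n∸1 = ℕ.∸-monoˡ-≤ 1 n>2

    a = m ∸ 1 + l

    m∸1<N : m ∸ 1 < N
    m∸1<N = ℕ.≤-<-trans (ℕ.m≤m+n (m ∸ 1) l) (ℕ.m<m+n a (ℕ.<-trans (s≤s z≤n) n>2))

    N≡ : ∀ {n} → n > 2 → a + n ≡ suc (a + (n ∸ 1))
    N≡ {suc n} _ = ℕ.+-suc a n

    go : ∀ x → toℕ i ≡ x → degree i ≢ 1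
    go zero i≡0 = neighbours i≡0 1<N m∸1<N (ℕ.<⇒≢ 1<m∸1)
      (inj₁ (next-edge 0 1<N)) (inj₂ (inj₁ (inj₂ (refl , refl))))
      where
      1<N = ℕ.<-trans 1<m∸1 m∸1<N
    go (suc y) i≡1+y with suc (suc y) <? N
    ... | yes 2+y<N = neighbours i≡1+y (ℕ.<-trans (ℕ.n<1+n y) 1+y<N) 2+y<N
      (ℕ.<⇒≢ (ℕ.m<n⇒m<1+n (ℕ.n<1+n y)))
      (inj₂ (next-edge y 1+y<N)) (inj₁ (next-edge (suc y) 2+y<N))
      where
      1+y<N = subst (_< N) i≡1+y (toℕ<n i)
    ... | no  2+y≮N = neighbours i≡1+y (ℕ.<-trans (ℕ.n<1+n y) 1+y<N)
      (ℕ.m<m+n a (ℕ.<-trans (s≤s z≤n) n>2)) y≢a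
      (inj₂ (next-edge y 1+y<N)) (inj₁ (inj₂ (inj₂ (inj₂ (1+y≡last , refl)))))
      where
      1+y<N = subst (_< N) i≡1+y (toℕ<n i)
      1+y≡last : suc y ≡ a + (n ∸ 1)
      1+y≡last = ℕ.suc-injective (trans (ℕ.≤-antisym 1+y<N (ℕ.≮⇒≥ 2+y≮N)) (N≡ n>2))
      y≢a : y ≢ a
      y≢a refl = ℕ.<⇒≢ 1<n∸1 (ℕ.+-cancelˡ-≡ a _ _ (trans (ℕ.+-comm a 1) 1+y≡last))

handcuff : ∀ m n l → m > 2 → n > 2 → l > 0 → LeaflessConnectedGraph (m ∸ 1 + l + n)
handcuff m n l m>2 n>2 _ = record
  { graph     = handcuffGraph m n l m>2 n>2
  ; connected = consecutive⇒connected (handcuffGraph m n l m>2 n>2) (handcuff-consecutive m>2 n>2)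
  ; leafless  = handcuff-leafless m>2 n>2
  }

{-# OPTIONS --safe #-}
module Submission where

-- Write y for the determinant of the principal submatrix on the vertices ≥ i. Eliminating a
-- degree-2 vertex of a path gives y = (1 + u²) y′ − u² y″, whose characteristic roots are 1 and u²,
-- so y − u² y′ is constant along a path and y − y′ is multiplied by u² at each step. A cycle
-- through vertex 0 is cut by expanding row 0 and column 0, which contributes the two directed
-- traversals −2u^m times the determinant of the rest. Starting from the cycle C_n one finds
-- y − u² y′ = (1 − uⁿ)² and y − y′ = 2uⁿ(uⁿ − 1), transports this pair along the joining path, and
-- closes up C_m; since r = 2, a single factor 1 − u² is available, and it is exactly what is needed
-- to express y through the pair without division.

open import Defs
open import Algebra.Bundles using (CommutativeRing; Semiring)
open import Algebra.Solver.Ring.AlmostCommutativeRing using (fromCommutativeRing; _-Raw-AlmostCommutative⟶_)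
open import Data.Bool.Base using (if_then_else_; true; false)
open import Data.Fin.Base as Fin using (Fin; toℕ; punchIn)
import Data.Fin.Properties as Fin
open import Data.Integer.Base as ℤ using (ℤ; +_; -[1+_]; _⊖_)
import Data.Integer.Properties as ℤ
open import Data.List.Base using (length; filter; map; tabulate; cartesianProduct; _++_)
open import Data.List.Properties using (filter-++; length-++; map-tabulate)
open import Data.Maybe.Base using (Maybe; just; nothing)
open import Data.Nat.Base as ℕ using (ℕ; zero; suc; _≤_; _<_; _>_; _≡ᵇ_; _∸_; z≤n; s≤s; z<s; s<s) renaming (_+_ to _+ℕ_; _*_ to _*ℕ_)
open import Data.Nat.Properties as ℕ using (_≟_)
open import Data.Product.Base using (_,_; proj₁; proj₂) renaming (_×_ to _∧_)
open import Data.Sum.Base using (_⊎_; inj₁; inj₂; swap; [_,_]′)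
open import Function.Base using (_∘_; id)
open import Function.Bundles using (_⇔_; mk⇔)
open import Relation.Binary.Definitions using (tri<; tri≈; tri>)
open import Relation.Binary.PropositionalEquality as ≡ using (_≡_; _≢_)
open import Relation.Nullary.Decidable using (Dec; yes; no; does; _×-dec_; _⊎-dec_; does-⇔; dec-true; dec-false)
open import Relation.Nullary.Negation using (¬_; contradiction)
open import Relation.Unary using (Pred; Decidable)
import Algebra.Properties.Semiring.Exp as Exp
import Algebra.Properties.Semiring.Mult as Mult
import Algebra.Properties.Semiring.Sum as Sum
import Algebra.Solver.CommutativeMonoid as CommutativeMonoidSolver
import Algebra.Solver.Ring as RingSolver

-- The numbering of the vertices makes 0, 1, ..., N - 1 a Hamiltonian path, so the handcuff graph is
-- this path with two chords, {0, m - 1} and {a, N - 1}, where a = m - 1 + l. All the combinatorics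
-- comes from this reading: the degrees are 2, plus one at each of m - 1 and a; there are N + 1
-- edges; and above the diagonal the matrix has -u next to the diagonal and at the two chord
-- positions, and 0 elsewhere. The ring is arbitrary, so 1 - u², the difference of the
-- characteristic roots, may be a zero divisor, and the recurrence cannot be solved explicitly. Only
-- multiples (1 - u²) y are computed, from (1 - u²) y = (y - u² y′) - u² (y - y′), and geometric
-- sums stay sums until they meet this factor.

-- Ring normalisation with integer coefficients

module IntegerCoefficients {c ℓ} (R : CommutativeRing c ℓ) where
  open CommutativeRing R
  open import Algebra.Properties.Semiring.Mult.TCOptimised semiring using (_×_; ×-homo-+; ×1-homo-*; 1+×)
  open import Algebra.Properties.Ring ring using (-‿distribˡ-*; -‿distribʳ-*; -0#≈0#; -‿involutive)
  open import Algebra.Properties.AbelianGroup +-abelianGroup using (⁻¹-∙-comm; xyx⁻¹≈y)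
  open import Relation.Binary.Reasoning.Setoid setoid

  -- With this form of `×`, the integer 1 evaluates to `1#` itself and not to a sum with `0#`, so
  -- solved equations match the goals as they are written.
  ⟦_⟧ℤ : ℤ → Carrier
  ⟦ + n      ⟧ℤ = n × 1#
  ⟦ -[1+ n ] ⟧ℤ = - (suc n × 1#)

  ⊖-homo : ∀ m n → ⟦ m ⊖ n ⟧ℤ ≈ m × 1# - n × 1#
  ⊖-homo m zero = begin
    m × 1#       ≈⟨ +-identityʳ _ ⟨
    m × 1# + 0#  ≈⟨ +-congˡ -0#≈0# ⟨
    m × 1# - 0#  ∎
  ⊖-homo zero (suc n) = sym (+-identityˡ _)
  ⊖-homo (suc m) (suc n) = begin
    ⟦ suc m ⊖ suc n ⟧ℤ                    ≡⟨ ≡.cong ⟦_⟧ℤ (ℤ.[1+m]⊖[1+n]≡m⊖n m n) ⟩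
    ⟦ m ⊖ n ⟧ℤ                            ≈⟨ ⊖-homo m n ⟩
    m × 1# - n × 1#                       ≈⟨ +-congʳ (xyx⁻¹≈y 1# (m × 1#)) ⟨
    1# + m × 1# - 1# - n × 1#             ≈⟨ +-assoc _ _ _ ⟩
    1# + m × 1# + (- 1# - n × 1#)         ≈⟨ +-congˡ (⁻¹-∙-comm 1# (n × 1#)) ⟩
    1# + m × 1# - (1# + n × 1#)           ≈⟨ +-cong (1+× m 1#) (-‿cong (1+× n 1#)) ⟨
    suc m × 1# - suc n × 1#               ∎

  +-homo : ∀ i j → ⟦ i ℤ.+ j ⟧ℤ ≈ ⟦ i ⟧ℤ + ⟦ j ⟧ℤ
  +-homo (+ m)      (+ n)      = ×-homo-+ 1# m n
  +-homo (+ m)      -[1+ n ]   = ⊖-homo m (suc n)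
  +-homo -[1+ m ]   (+ n)      = trans (⊖-homo n (suc m)) (+-comm _ _)
  +-homo -[1+ m ]   -[1+ n ]   = begin
    - (suc (suc (m ℕ.+ n)) × 1#)      ≡⟨ ≡.cong (λ k → - (suc k × 1#)) (ℕ.+-suc m n) ⟨
    - ((suc m ℕ.+ suc n) × 1#)        ≈⟨ -‿cong (×-homo-+ 1# (suc m) (suc n)) ⟩
    - (suc m × 1# + suc n × 1#)       ≈⟨ ⁻¹-∙-comm _ _ ⟨
    - (suc m × 1#) - suc n × 1#       ∎

  neg-homo : ∀ i → ⟦ ℤ.- i ⟧ℤ ≈ - ⟦ i ⟧ℤ
  neg-homo (+ zero)  = sym -0#≈0#
  neg-homo (+ suc n) = refl
  neg-homo -[1+ n ]  = sym (-‿involutive _)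

  *-homo-+ : ∀ m n → ⟦ + m ℤ.* + n ⟧ℤ ≈ (m × 1#) * (n × 1#)
  *-homo-+ m n = begin
    ⟦ + m ℤ.* + n ⟧ℤ     ≡⟨ ≡.cong ⟦_⟧ℤ (ℤ.pos-* m n) ⟨
    (m ℕ.* n) × 1#       ≈⟨ ×1-homo-* m n ⟩
    (m × 1#) * (n × 1#)  ∎

  *-homoˡ : ∀ m j → ⟦ + m ℤ.* j ⟧ℤ ≈ (m × 1#) * ⟦ j ⟧ℤ
  *-homoˡ m (+ n)    = *-homo-+ m n
  *-homoˡ m -[1+ n ] = begin
    ⟦ + m ℤ.* -[1+ n ] ⟧ℤ            ≡⟨ ≡.cong ⟦_⟧ℤ (ℤ.neg-distribʳ-* (+ m) (+ suc n)) ⟨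
    ⟦ ℤ.- (+ m ℤ.* + suc n) ⟧ℤ       ≈⟨ neg-homo (+ m ℤ.* + suc n) ⟩
    - ⟦ + m ℤ.* + suc n ⟧ℤ           ≈⟨ -‿cong (*-homo-+ m (suc n)) ⟩
    - ((m × 1#) * (suc n × 1#))      ≈⟨ -‿distribʳ-* _ _ ⟩
    (m × 1#) * - (suc n × 1#)        ∎

  *-homo : ∀ i j → ⟦ i ℤ.* j ⟧ℤ ≈ ⟦ i ⟧ℤ * ⟦ j ⟧ℤ
  *-homo (+ m)    j = *-homoˡ m j
  *-homo -[1+ m ] j = begin
    ⟦ -[1+ m ] ℤ.* j ⟧ℤ              ≡⟨ ≡.cong ⟦_⟧ℤ (ℤ.neg-distribˡ-* (+ suc m) j) ⟨
    ⟦ ℤ.- (+ suc m ℤ.* j) ⟧ℤ         ≈⟨ neg-homo (+ suc m ℤ.* j) ⟩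
    - ⟦ + suc m ℤ.* j ⟧ℤ             ≈⟨ -‿cong (*-homoˡ (suc m) j) ⟩
    - ((suc m × 1#) * ⟦ j ⟧ℤ)        ≈⟨ -‿distribˡ-* _ _ ⟩
    - (suc m × 1#) * ⟦ j ⟧ℤ          ∎

  ℤ⟶R : ℤ.+-*-rawRing -Raw-AlmostCommutative⟶ fromCommutativeRing R
  ℤ⟶R = record
    { ⟦_⟧    = ⟦_⟧ℤ
    ; +-homo = +-homo
    ; *-homo = *-homo
    ; -‿homo = neg-homo
    ; 0-homo = refl
    ; 1-homo = refl
    }

  -- Coefficients are compared in ℤ, so no decidable equality on the ring is required. Distinct
  -- integers may still agree in the ring, hence `nothing`.
  _coeff≟_ : ∀ i j → Maybe (⟦ i ⟧ℤ ≈ ⟦ j ⟧ℤ)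
  i coeff≟ j with i ℤ.≟ j
  ... | yes ≡.refl = just refl
  ... | no  _      = nothing

  open RingSolver ℤ.+-*-rawRing (fromCommutativeRing R) ℤ⟶R _coeff≟_ public

  :0 :1 : ∀ {n} → Polynomial n
  :0 = con (+ 0)
  :1 = con (+ 1)

-- Finite sums over ℕ and Kronecker deltas

module Kronecker {c ℓ} (S : Semiring c ℓ) where
  open Semiring S hiding (zero)
  open Sum S

  -- Built on `≡ᵇ`, so that a common `suc` cancels by computation and the test agrees by computation
  -- with `does (p ≟ q)`.
  δ : ℕ → ℕ → Carrier
  δ p q = if p ≡ᵇ q then 1# else 0#

  opaque
    ∑< : ℕ → (ℕ → Carrier) → Carrier
    ∑< n g = sum {n} λ i → g (toℕ i)

    ∑<≈sum : ∀ n g → ∑< n g ≈ sum {n} λ i → g (toℕ i)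
    ∑<≈sum n g = refl

    ∑<-zero : ∀ g → ∑< 0 g ≈ 0#
    ∑<-zero g = refl

    ∑<-suc : ∀ n g → ∑< (suc n) g ≈ g 0 + ∑< n λ j → g (suc j)
    ∑<-suc n g = refl

    ∑<-cong : ∀ n {g h} → (∀ j → g j ≈ h j) → ∑< n g ≈ ∑< n h
    ∑<-cong n {g} {h} g≈h = sum-cong-≋ {n} {λ i → g (toℕ i)} {λ i → h (toℕ i)} λ i → g≈h (toℕ i)

    ∑<-+ : ∀ n g h → ∑< n (λ j → g j + h j) ≈ ∑< n g + ∑< n h
    ∑<-+ n g h = ∑-distrib-+ {n} (λ i → g (toℕ i)) (λ i → h (toℕ i))

    *-∑< : ∀ n a g → a * ∑< n g ≈ ∑< n λ j → a * g j
    *-∑< n a g = *-distribˡ-sum {n} a λ i → g (toℕ i)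

    ∑<-comm : ∀ m n (g : ℕ → ℕ → Carrier) → ∑< m (λ i → ∑< n λ j → g i j) ≈ ∑< n (λ j → ∑< m λ i → g i j)
    ∑<-comm m n g = ∑-comm {m} {n} λ i j → g (toℕ i) (toℕ j)

    ∑<-0 : ∀ n {g} → (∀ j → g j ≈ 0#) → ∑< n g ≈ 0#
    ∑<-0 n {g} g≈0 = trans (∑<-cong n g≈0) (sum-replicate-zero n)

  ∑<-δ : ∀ {n p} (g : ℕ → Carrier) → p < n → ∑< n (λ j → δ p j * g j) ≈ g p
  ∑<-δ {suc n} {zero} g _ = trans (∑<-suc n _)
    (trans (+-cong (*-identityˡ (g 0)) (∑<-0 n λ j → zeroˡ (g (suc j)))) (+-identityʳ _))
  ∑<-δ {suc n} {suc p} g (s<s p<n) = trans (∑<-suc n _)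
    (trans (+-cong (zeroˡ (g 0)) (∑<-δ (λ j → g (suc j)) p<n)) (+-identityˡ _))

-- The order embedding ℕ → ℕ missing p, i.e. punchIn without bounds.
skip : ℕ → ℕ → ℕ
skip zero    k       = suc k
skip (suc p) zero    = zero
skip (suc p) (suc k) = suc (skip p k)

toℕ-punchIn : ∀ {n} (j : Fin (suc n)) (k : Fin n) → toℕ (punchIn j k) ≡ skip (toℕ j) (toℕ k)
toℕ-punchIn Fin.zero    k           = ≡.refl
toℕ-punchIn (Fin.suc j) Fin.zero    = ≡.refl
toℕ-punchIn (Fin.suc j) (Fin.suc k) = ≡.cong suc (toℕ-punchIn j k)

-- Laplace expansion along rows and columns

module Determinant {c ℓ} (R : CommutativeRing c ℓ) where
  open CommutativeRing R hiding (zero)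
  open Exp semiring using (_^_)
  open Sum semiring using (sum-cong-≋)
  open Kronecker semiring
  open IntegerCoefficients R using (solve; :0; :1; _:=_; _:+_; _:*_; _:-_; :-_; _:^_)
  open import Relation.Binary.Reasoning.Setoid setoid

  det-cong : ∀ {n} {M M′ : Matrix R n} → (∀ i j → M i j ≈ M′ i j) → det R M ≈ det R M′
  det-cong {zero}  M≈M′ = refl
  det-cong {suc n} M≈M′ = sum-cong-≋ {suc n} λ j →
    *-congˡ {(- 1#) ^ toℕ j} (*-cong (M≈M′ Fin.zero j) (det-cong λ i k → M≈M′ (Fin.suc i) (punchIn j k)))

  ℕMatrix : Set c
  ℕMatrix = ℕ → ℕ → Carrier

  sign : ℕ → Carrier
  sign j = (- 1#) ^ j

  opaque
    unfolding ∑<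

    -- An infinite matrix is read through its upper left block. Minors are then reindexings by `suc`
    -- and `skip`, free of bounds on the indices.
    D : ℕ → ℕMatrix → Carrier
    D n B = det R {n} λ i j → B (toℕ i) (toℕ j)

    D≈det : ∀ n B → D n B ≈ det R {n} λ i j → B (toℕ i) (toℕ j)
    D≈det n B = refl

    D-zero : ∀ B → D 0 B ≈ 1#
    D-zero B = refl

    D-cong : ∀ n {B B′ : ℕMatrix} → (∀ i j → B i j ≈ B′ i j) → D n B ≈ D n B′
    D-cong n B≈B′ = det-cong {n} λ i j → B≈B′ (toℕ i) (toℕ j)

    row-expansion : ∀ n B → D (suc n) B ≈
      ∑< (suc n) λ j → sign j * (B 0 j * D n λ r c → B (suc r) (skip j c))
    row-expansion n B = sum-cong-≋ {suc n} λ j → *-congˡ {sign (toℕ j)} (*-congˡ {B 0 (toℕ j)} (det-cong λ r c →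
      reflexive (≡.cong (B (suc (toℕ r))) (toℕ-punchIn j c))))

  row-expansion′ : ∀ n B → D (suc n) B ≈
    B 0 0 * D n (λ r c → B (suc r) (suc c)) +
    ∑< n λ j → sign (suc j) * (B 0 (suc j) * D n λ r c → B (suc r) (skip (suc j) c))
  row-expansion′ n B = trans (row-expansion n B) (trans (∑<-suc n _) (+-congʳ (*-identityˡ _)))

  private
    interchange : ∀ s t a b d → - 1# * s * (a * (t * (b * d))) ≈ - 1# * t * (b * (s * (a * d)))
    interchange = solve 5 (λ s t a b d →
      :- :1 :* s :* (a :* (t :* (b :* d))) := :- :1 :* t :* (b :* (s :* (a :* d)))) refl

  -- Expanding row 0, and then column 0 of every minor except that of the corner, gives a double
  -- sum. Its terms are symmetric in the two expansions, as (-1)^(j+1) (-1)^i = (-1)^(i+1) (-1)^j,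
  -- so exchanging the sums and undoing the row expansions leaves the expansion along column 0.
  column-expansion : ∀ n B → D (suc n) B ≈
    ∑< (suc n) λ i → sign i * (B i 0 * D n λ r c → B (skip i r) (suc c))
  column-expansion zero    B = begin
    D 1 B                                ≈⟨ row-expansion 0 B ⟩
    _                                    ≈⟨ ∑<-suc 0 _ ⟩
    _                                    ≈⟨ +-congˡ (trans (∑<-zero _) (sym (∑<-zero _))) ⟩
    _                                    ≈⟨ ∑<-suc 0 (λ i → sign i * (B i 0 * D 0 λ r c → B (skip i r) (suc c))) ⟨
    _                                    ∎
  column-expansion (suc n) B = begin
    D (suc (suc n)) B
      ≈⟨ row-expansion′ (suc n) B ⟩
    corner + ∑< (suc n) (λ j → sign (suc j) * (B 0 (suc j) * D (suc n) λ r c → B (suc r) (skip (suc j) c)))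
      ≈⟨ +-congˡ (∑<-cong (suc n) expand) ⟩
    corner + ∑< (suc n) (λ j → ∑< (suc n) λ i → term i j)
      ≈⟨ +-congˡ (∑<-comm (suc n) (suc n) (λ j i → term i j)) ⟩
    corner + ∑< (suc n) (λ i → ∑< (suc n) λ j → term i j)
      ≈⟨ +-congˡ (∑<-cong (suc n) contract) ⟩
    corner + ∑< (suc n) (λ i → sign (suc i) * (B (suc i) 0 * D (suc n) λ r c → B (skip (suc i) r) (suc c)))
      ≈⟨ +-congʳ (*-identityˡ corner) ⟨
    1# * corner + ∑< (suc n) (λ i → sign (suc i) * (B (suc i) 0 * D (suc n) λ r c → B (skip (suc i) r) (suc c)))
      ≈⟨ ∑<-suc (suc n) _ ⟨
    ∑< (suc (suc n)) (λ i → sign i * (B i 0 * D (suc n) λ r c → B (skip i r) (suc c))) ∎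
    where
    corner : Carrier
    corner = B 0 0 * D (suc n) λ r c → B (suc r) (suc c)

    E : ℕ → ℕ → Carrier
    E i j = D n λ r c → B (suc (skip i r)) (suc (skip j c))

    term : ℕ → ℕ → Carrier
    term i j = sign (suc j) * (B 0 (suc j) * (sign i * (B (suc i) 0 * E i j)))

    expand : ∀ j → sign (suc j) * (B 0 (suc j) * D (suc n) λ r c → B (suc r) (skip (suc j) c)) ≈
      ∑< (suc n) λ i → term i j
    expand j = begin
      sign (suc j) * (B 0 (suc j) * D (suc n) λ r c → B (suc r) (skip (suc j) c))
        ≈⟨ *-congˡ (*-congˡ (column-expansion n λ r c → B (suc r) (skip (suc j) c))) ⟩
      sign (suc j) * (B 0 (suc j) * ∑< (suc n) λ i → sign i * (B (suc i) 0 * E i j))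
        ≈⟨ *-congˡ (*-∑< (suc n) _ _) ⟩
      sign (suc j) * (∑< (suc n) λ i → B 0 (suc j) * (sign i * (B (suc i) 0 * E i j)))
        ≈⟨ *-∑< (suc n) _ _ ⟩
      ∑< (suc n) (λ i → term i j) ∎

    contract : ∀ i → ∑< (suc n) (λ j → term i j) ≈
      sign (suc i) * (B (suc i) 0 * D (suc n) λ r c → B (skip (suc i) r) (suc c))
    contract i = sym (begin
      sign (suc i) * (B (suc i) 0 * D (suc n) λ r c → B (skip (suc i) r) (suc c))
        ≈⟨ *-congˡ (*-congˡ (row-expansion n λ r c → B (skip (suc i) r) (suc c))) ⟩
      sign (suc i) * (B (suc i) 0 * ∑< (suc n) λ j → sign j * (B 0 (suc j) * E i j))
        ≈⟨ *-congˡ (*-∑< (suc n) _ _) ⟩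
      sign (suc i) * ∑< (suc n) (λ j → B (suc i) 0 * (sign j * (B 0 (suc j) * E i j)))
        ≈⟨ *-∑< (suc n) _ _ ⟩
      ∑< (suc n) (λ j → sign (suc i) * (B (suc i) 0 * (sign j * (B 0 (suc j) * E i j))))
        ≈⟨ ∑<-cong (suc n) (λ j → interchange (sign i) (sign j) (B (suc i) 0) (B 0 (suc j)) (E i j)) ⟩
      ∑< (suc n) (λ j → term i j) ∎)

  D-transpose : ∀ n B → D n B ≈ D n λ i j → B j i
  D-transpose zero    B = trans (D-zero B) (sym (D-zero λ i j → B j i))
  D-transpose (suc n) B = begin
    D (suc n) B
      ≈⟨ row-expansion n B ⟩
    ∑< (suc n) (λ j → sign j * (B 0 j * D n λ r c → B (suc r) (skip j c)))
      ≈⟨ ∑<-cong (suc n) (λ j → *-congˡ (*-congˡ (D-transpose n λ r c → B (suc r) (skip j c)))) ⟩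
    ∑< (suc n) (λ j → sign j * (B 0 j * D n λ r c → B (suc c) (skip j r)))
      ≈⟨ column-expansion n (λ i j → B j i) ⟨
    D (suc n) (λ i j → B j i) ∎

  -- Signs, entries and minors stay abstract, so that the same lemma collapses row expansions, with
  -- or without the corner term, and column expansions.
  cofactor-sum₁ : ∀ {n p} (s v d : ℕ → Carrier) {a} → p < n → (∀ j → v j ≈ a * δ p j) →
    ∑< n (λ j → s j * (v j * d j)) ≈ s p * (a * d p)
  cofactor-sum₁ {n} {p} s v d {a} p<n v≈ = trans
    (∑<-cong n λ j → trans (*-congˡ (*-congʳ (v≈ j))) (rearrange (s j) a (δ p j) (d j)))
    (∑<-δ (λ j → s j * (a * d j)) p<n)
    where
    rearrange : ∀ s a e d → s * (a * e * d) ≈ e * (s * (a * d))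
    rearrange = solve 4 (λ s a e d → s :* (a :* e :* d) := e :* (s :* (a :* d))) refl

  cofactor-sum₂ : ∀ {n p q} (s v d : ℕ → Carrier) {a b} → p < n → q < n →
    (∀ j → v j ≈ a * δ p j + b * δ q j) →
    ∑< n (λ j → s j * (v j * d j)) ≈ s p * (a * d p) + s q * (b * d q)
  cofactor-sum₂ {n} {p} {q} s v d {a} {b} p<n q<n v≈ = begin
    ∑< n (λ j → s j * (v j * d j))
      ≈⟨ ∑<-cong n (λ j → trans (*-congˡ (*-congʳ (v≈ j))) (rearrange (s j) a (δ p j) b (δ q j) (d j))) ⟩
    ∑< n (λ j → δ p j * (s j * (a * d j)) + δ q j * (s j * (b * d j)))
      ≈⟨ ∑<-+ n _ _ ⟩
    ∑< n (λ j → δ p j * (s j * (a * d j))) + ∑< n (λ j → δ q j * (s j * (b * d j)))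
      ≈⟨ +-cong (∑<-δ (λ j → s j * (a * d j)) p<n) (∑<-δ (λ j → s j * (b * d j)) q<n) ⟩
    s p * (a * d p) + s q * (b * d q) ∎
    where
    rearrange : ∀ s a e b f d → s * ((a * e + b * f) * d) ≈ e * (s * (a * d)) + f * (s * (b * d))
    rearrange = solve 6 (λ s a e b f d →
      s :* ((a :* e :+ b :* f) :* d) := e :* (s :* (a :* d)) :+ f :* (s :* (b :* d))) refl

  isolated-vertex : ∀ n (B : ℕMatrix) → (∀ j → B 0 (suc j) ≈ 0#) →
    D (suc n) B ≈ B 0 0 * D n λ i j → B (suc i) (suc j)
  isolated-vertex n B row = begin
    D (suc n) B
      ≈⟨ row-expansion′ n B ⟩
    B 0 0 * D n (λ i j → B (suc i) (suc j)) +
      ∑< n (λ j → sign (suc j) * (B 0 (suc j) * D n λ r c → B (suc r) (skip (suc j) c)))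
      ≈⟨ +-congˡ (∑<-0 n λ j → trans (*-congˡ (trans (*-congʳ (row j)) (zeroˡ _))) (zeroʳ _)) ⟩
    B 0 0 * D n (λ i j → B (suc i) (suc j)) + 0#
      ≈⟨ +-identityʳ _ ⟩
    B 0 0 * D n (λ i j → B (suc i) (suc j)) ∎

  -- x is the diagonal, and f i d is the entry in position (i, i + 1 + d).
  symmetric : (ℕ → Carrier) → (ℕ → ℕ → Carrier) → ℕMatrix
  symmetric x f zero    zero    = x 0
  symmetric x f zero    (suc j) = f 0 j
  symmetric x f (suc i) zero    = f 0 i
  symmetric x f (suc i) (suc j) = symmetric (x ∘ suc) (f ∘ suc) i j

  symmetric-sym : ∀ x f i j → symmetric x f i j ≡ symmetric x f j i
  symmetric-sym x f zero    zero    = ≡.refl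
  symmetric-sym x f zero    (suc j) = ≡.refl
  symmetric-sym x f (suc i) zero    = ≡.refl
  symmetric-sym x f (suc i) (suc j) = symmetric-sym (x ∘ suc) (f ∘ suc) i j

  symmetric-diagonal : ∀ x f i → symmetric x f i i ≡ x i
  symmetric-diagonal x f zero    = ≡.refl
  symmetric-diagonal x f (suc i) = symmetric-diagonal (x ∘ suc) (f ∘ suc) i

  symmetric-upper : ∀ x f i d → symmetric x f i (suc (i +ℕ d)) ≡ f i d
  symmetric-upper x f zero    d = ≡.refl
  symmetric-upper x f (suc i) d = symmetric-upper (x ∘ suc) (f ∘ suc) i d

  symmetric-cong : ∀ {x x′ f f′} → (∀ i → x i ≈ x′ i) → (∀ i d → f i d ≈ f′ i d) →
    ∀ i j → symmetric x f i j ≈ symmetric x′ f′ i j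
  symmetric-cong x≈ f≈ zero    zero    = x≈ 0
  symmetric-cong x≈ f≈ zero    (suc j) = f≈ 0 j
  symmetric-cong x≈ f≈ (suc i) zero    = f≈ 0 i
  symmetric-cong x≈ f≈ (suc i) (suc j) = symmetric-cong (λ i → x≈ (suc i)) (λ i → f≈ (suc i)) i j

  -- Determinants of paths and cycles

  module _ (u : Carrier) where

    -- Nothing is asked of vertex `t`, so a path may run into a vertex of any kind. Links to smaller
    -- vertices are covered by the symmetry of the matrix.
    IsPath : ℕ → (ℕ → Carrier) → (ℕ → ℕ → Carrier) → Set ℓ
    IsPath t x f = ∀ i → i < t → (x i ≈ 1# + u ^ 2) ∧ (∀ j → f i j ≈ - u * δ 0 j)

    IsPath-tail : ∀ {t x f} → IsPath (suc t) x f → IsPath t (x ∘ suc) (f ∘ suc)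
    IsPath-tail path i i<t = path (suc i) (s<s i<t)

    -- The geometric sum 1 + u² + ... + u^(2t) in Horner form, which makes sense when 1 - u² is not
    -- invertible.
    pathDet : ℕ → Carrier
    pathDet zero    = 1#
    pathDet (suc t) = 1# + u ^ 2 * pathDet t

    pathDet-step : ∀ t → (1# + u ^ 2) * pathDet (suc t) - u ^ 2 * pathDet t ≈ pathDet (suc (suc t))
    pathDet-step t = solve 2 (λ u K →
      (:1 :+ u :^ 2) :* (:1 :+ u :^ 2 :* K) :- u :^ 2 :* K :=
      :1 :+ u :^ 2 :* (:1 :+ u :^ 2 :* K)) refl u (pathDet t)

    pathDet-difference : ∀ t → pathDet (suc t) - pathDet t ≈ (u ^ suc t) ^ 2
    pathDet-difference zero    =
      solve 1 (λ u → :1 :+ u :^ 2 :* :1 :- :1 := (u :* :1) :^ 2) refl u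
    pathDet-difference (suc t) = begin
      pathDet (suc (suc t)) - pathDet (suc t)
        ≈⟨ solve 3 (λ u K K′ → :1 :+ u :^ 2 :* K :- (:1 :+ u :^ 2 :* K′) := u :^ 2 :* (K :- K′))
             refl u (pathDet (suc t)) (pathDet t) ⟩
      u ^ 2 * (pathDet (suc t) - pathDet t)
        ≈⟨ *-congˡ (pathDet-difference t) ⟩
      u ^ 2 * (u ^ suc t) ^ 2
        ≈⟨ solve 2 (λ u p → u :^ 2 :* p :^ 2 := (u :* p) :^ 2) refl u (u ^ suc t) ⟩
      (u ^ suc (suc t)) ^ 2 ∎

    pathDet-geometric : ∀ t → (1# - u ^ 2) * pathDet t ≈ 1# - (u ^ suc t) ^ 2
    pathDet-geometric t = begin
      (1# - u ^ 2) * pathDet t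
        ≈⟨ solve 2 (λ u K → (:1 :- u :^ 2) :* K := :1 :- (:1 :+ u :^ 2 :* K :- K)) refl u (pathDet t) ⟩
      1# - (pathDet (suc t) - pathDet t)
        ≈⟨ +-congˡ (-‿cong (pathDet-difference t)) ⟩
      1# - (u ^ suc t) ^ 2 ∎

    -- In the minor without row 0 and column 1, column 0 again has the single entry -u, at the top,
    -- so the double expansion leaves one term. The hypotheses concern row 0 and column 0 only,
    -- which lets the lemma apply to matrices with a vertex deleted further on.
    leading-vertex : ∀ n (B : ℕMatrix) → (∀ j → B 0 (suc j) ≈ - u * δ 0 j) → (∀ i → B (suc i) 0 ≈ - u * δ 0 i) →
      D (suc (suc n)) B ≈ B 0 0 * D (suc n) (λ i j → B (suc i) (suc j))
                          - u ^ 2 * D n (λ i j → B (suc (suc i)) (suc (suc j)))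
    leading-vertex n B row column = begin
      D (suc (suc n)) B
        ≈⟨ row-expansion′ (suc n) B ⟩
      B 0 0 * P + ∑< (suc n) (λ j → sign (suc j) * (B 0 (suc j) * minor j))
        ≈⟨ +-congˡ (cofactor-sum₁ (sign ∘ suc) (B 0 ∘ suc) minor z<s row) ⟩
      B 0 0 * P + sign 1 * (- u * minor 0)
        ≈⟨ +-congˡ (*-congˡ (*-congˡ (trans (column-expansion n λ i j → B (suc i) (skip 1 j))
             (cofactor-sum₁ sign (λ i → B (suc i) 0) (λ i → D n λ r c → B (suc (skip i r)) (suc (suc c))) z<s column)))) ⟩
      B 0 0 * P + sign 1 * (- u * (sign 0 * (- u * Q)))
        ≈⟨ simplify (B 0 0) P Q u ⟩
      B 0 0 * P - u ^ 2 * Q ∎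
      where
      P = D (suc n) (λ i j → B (suc i) (suc j))
      Q = D n (λ i j → B (suc (suc i)) (suc (suc j)))
      minor : ℕ → Carrier
      minor j = D (suc n) λ r c → B (suc r) (skip (suc j) c)
      simplify : ∀ x p q u → x * p + - 1# * 1# * (- u * (1# * (- u * q))) ≈ x * p - u ^ 2 * q
      simplify = solve 4 (λ x p q u →
        x :* p :+ :- :1 :* :1 :* (:- u :* (:1 :* (:- u :* q))) :=
        x :* p :- u :^ 2 :* q) refl

    D-path : ∀ t {x f} → IsPath t x f → D t (symmetric x f) ≈ pathDet t
    D-path zero {x} {f} path = D-zero (symmetric x f)
    D-path (suc zero) {x} {f} path = begin
      D 1 (symmetric x f)   ≈⟨ row-expansion′ 0 (symmetric x f) ⟩
      _                     ≈⟨ +-cong (*-congˡ (D-zero _)) (∑<-zero _) ⟩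
      x 0 * 1# + 0#         ≈⟨ trans (+-identityʳ _) (*-identityʳ _) ⟩
      x 0                   ≈⟨ proj₁ (path 0 z<s) ⟩
      1# + u ^ 2            ≈⟨ +-congˡ (*-identityʳ _) ⟨
      1# + u ^ 2 * 1#       ∎
    D-path (suc (suc t)) {x} {f} path = begin
      D (suc (suc t)) (symmetric x f)
        ≈⟨ leading-vertex t (symmetric x f) link link ⟩
      x 0 * D (suc t) (symmetric (x ∘ suc) (f ∘ suc)) - u ^ 2 * D t (symmetric (x ∘ suc ∘ suc) (f ∘ suc ∘ suc))
        ≈⟨ +-cong (*-cong (proj₁ (path 0 z<s)) (D-path (suc t) (IsPath-tail {x = x} {f} path)))
                  (-‿cong (*-congˡ (D-path t (IsPath-tail {x = x ∘ suc} {f ∘ suc} (IsPath-tail {x = x} {f} path))))) ⟩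
      (1# + u ^ 2) * pathDet (suc t) - u ^ 2 * pathDet t
        ≈⟨ pathDet-step t ⟩
      pathDet (suc (suc t)) ∎
      where link = proj₂ (path 0 z<s)

    -- Deleting vertex `k` cuts the path before it from everything after it, so the matrix becomes
    -- block diagonal. The path recurrence still applies, and its base case is a path vertex that
    -- has lost its only upward link.
    D-path-skip : ∀ k n {x f} → IsPath k x f →
      D (k +ℕ n) (λ i j → symmetric x f (skip k i) (skip k j)) ≈
      pathDet k * D n (symmetric (λ i → x (suc k +ℕ i)) (λ i → f (suc k +ℕ i)))
    D-path-skip zero n path = sym (*-identityˡ _)
    D-path-skip (suc zero) n {x} {f} path = begin
      D (suc n) (λ i j → symmetric x f (skip 1 i) (skip 1 j))
        ≈⟨ isolated-vertex n (λ i j → symmetric x f (skip 1 i) (skip 1 j)) (λ j → trans (proj₂ (path 0 z<s) (suc j)) (zeroʳ _)) ⟩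
      x 0 * R′
        ≈⟨ *-congʳ (trans (proj₁ (path 0 z<s)) (+-congˡ (sym (*-identityʳ _)))) ⟩
      pathDet 1 * R′ ∎
      where R′ = D n (symmetric (λ i → x (2 +ℕ i)) (λ i → f (2 +ℕ i)))
    D-path-skip (suc (suc k)) n {x} {f} path = begin
      D (suc (suc (k +ℕ n))) (λ i j → symmetric x f (skip (suc (suc k)) i) (skip (suc (suc k)) j))
        ≈⟨ leading-vertex (k +ℕ n) (λ i j → symmetric x f (skip (suc (suc k)) i) (skip (suc (suc k)) j)) link link ⟩
      _ ≈⟨ +-cong (*-cong (proj₁ (path 0 z<s)) (D-path-skip (suc k) n (IsPath-tail {x = x} {f} path)))
                  (-‿cong (*-congˡ {u ^ 2} (D-path-skip k n (IsPath-tail {x = x ∘ suc} {f ∘ suc} (IsPath-tail {x = x} {f} path))))) ⟩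
      (1# + u ^ 2) * (pathDet (suc k) * R′) - u ^ 2 * (pathDet k * R′)
        ≈⟨ factor _ _ _ _ _ ⟩
      ((1# + u ^ 2) * pathDet (suc k) - u ^ 2 * pathDet k) * R′
        ≈⟨ *-congʳ (pathDet-step k) ⟩
      pathDet (suc (suc k)) * R′ ∎
      where
      R′ = D n (symmetric (λ i → x (suc (suc (suc k)) +ℕ i)) (λ i → f (suc (suc (suc k)) +ℕ i)))
      link : ∀ j → f 0 (skip (suc k) j) ≈ - u * δ 0 j
      link zero    = proj₂ (path 0 z<s) 0
      link (suc j) = proj₂ (path 0 z<s) (suc (skip k j))
      factor : ∀ a p b q r → a * (p * r) - b * (q * r) ≈ (a * p - b * q) * r
      factor = solve 5 (λ a p b q r → a :* (p :* r) :- b :* (q :* r) := (a :* p :- b :* q) :* r) refl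

    -- Deleting row `k` and column 0 moves the superdiagonal of the path onto the diagonal. The
    -- first `k` rows then have -u there and zeros to the right, so the matrix is block lower
    -- triangular: this is the path traversed in one direction.
    D-path-shifted : ∀ k n {x f} → IsPath k x f →
      D (k +ℕ n) (λ i j → symmetric x f (skip k i) (suc j)) ≈
      (- u) ^ k * D n (symmetric (λ i → x (suc k +ℕ i)) (λ i → f (suc k +ℕ i)))
    D-path-shifted zero    n path = sym (*-identityˡ _)
    D-path-shifted (suc k) n {x} {f} path = begin
      D (suc (k +ℕ n)) (λ i j → symmetric x f (skip (suc k) i) (suc j))
        ≈⟨ row-expansion (k +ℕ n) (λ i j → symmetric x f (skip (suc k) i) (suc j)) ⟩
      ∑< (suc (k +ℕ n)) (λ j → sign j * (f 0 j * D (k +ℕ n) λ r c → symmetric x f (suc (skip k r)) (suc (skip j c))))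
        ≈⟨ cofactor-sum₁ sign (f 0) (λ j → D (k +ℕ n) λ r c → symmetric x f (suc (skip k r)) (suc (skip j c)))
             z<s (proj₂ (path 0 z<s)) ⟩
      1# * (- u * D (k +ℕ n) (λ i j → symmetric (x ∘ suc) (f ∘ suc) (skip k i) (suc j)))
        ≈⟨ *-identityˡ _ ⟩
      - u * D (k +ℕ n) (λ i j → symmetric (x ∘ suc) (f ∘ suc) (skip k i) (suc j))
        ≈⟨ *-congˡ (D-path-shifted k n (IsPath-tail {x = x} {f} path)) ⟩
      - u * ((- u) ^ k * _)
        ≈⟨ *-assoc _ _ _ ⟨
      (- u) ^ suc k * _ ∎

    D-path-shiftedᵀ : ∀ k n {x f} → IsPath k x f →
      D (k +ℕ n) (λ i j → symmetric x f (suc i) (skip k j)) ≈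
      (- u) ^ k * D n (symmetric (λ i → x (suc k +ℕ i)) (λ i → f (suc k +ℕ i)))
    D-path-shiftedᵀ k n {x} {f} path = begin
      D (k +ℕ n) (λ i j → symmetric x f (suc i) (skip k j))
        ≈⟨ D-transpose (k +ℕ n) (λ i j → symmetric x f (suc i) (skip k j)) ⟩
      D (k +ℕ n) (λ i j → symmetric x f (suc j) (skip k i))
        ≈⟨ D-cong (k +ℕ n) (λ i j → reflexive (symmetric-sym x f (suc j) (skip k i))) ⟩
      D (k +ℕ n) (λ i j → symmetric x f (skip k i) (suc j))
        ≈⟨ D-path-shifted k n path ⟩
      _ ∎

    sign-sign : ∀ k → sign k * sign k ≈ 1#
    sign-sign zero    = *-identityˡ 1#
    sign-sign (suc k) = trans
      (solve 1 (λ s → :- :1 :* s :* (:- :1 :* s) := s :* s) refl (sign k)) (sign-sign k)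

    sign-power : ∀ k → sign k * (- u) ^ k ≈ u ^ k
    sign-power zero    = *-identityˡ 1#
    sign-power (suc k) = trans
      (solve 3 (λ s u p → :- :1 :* s :* (:- u :* p) := u :* (s :* p)) refl (sign k) u ((- u) ^ k))
      (*-congˡ (sign-power k))

    -- The cycle has `k + 2` vertices, and its last vertex `k + 1` may continue into the rest; `x 0`
    -- is left free because vertex 0 may have had smaller neighbours. Row 0 and column 0 have two
    -- off-diagonal entries each, hence four double cofactors: the edge to 1 taken back and forth,
    -- the edge to `k + 1` taken back and forth, and the two mixed ones, which are the two
    -- orientations of the cycle.
    D-cycle : ∀ k n {x f} → IsPath k (x ∘ suc) (f ∘ suc) → (∀ j → f 0 j ≈ - u * δ 0 j + - u * δ k j) →
      let rest = D n (symmetric (λ i → x (suc (suc k) +ℕ i)) (λ i → f (suc (suc k) +ℕ i))) in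
      D (suc (suc (k +ℕ n))) (symmetric x f) ≈
        x 0 * D (suc (k +ℕ n)) (symmetric (x ∘ suc) (f ∘ suc))
        - u ^ 2 * D (k +ℕ n) (symmetric (x ∘ suc ∘ suc) (f ∘ suc ∘ suc))
        - u ^ 2 * pathDet k * rest
        - (u ^ (2 +ℕ k) + u ^ (2 +ℕ k)) * rest
    D-cycle k n {x} {f} path link = begin
      D (suc (suc (k +ℕ n))) S
        ≈⟨ row-expansion′ (suc (k +ℕ n)) S ⟩
      x 0 * P + ∑< (suc (k +ℕ n)) (λ j → sign (suc j) * (f 0 j * minor j))
        ≈⟨ +-congˡ (cofactor-sum₂ (sign ∘ suc) (f 0) minor z<s k<n link) ⟩
      x 0 * P + (sign 1 * (- u * minor 0) + sign (suc k) * (- u * minor k))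
        ≈⟨ +-congˡ (+-cong (*-congˡ (*-congˡ minor₁)) (*-congˡ (*-congˡ minorₖ))) ⟩
      x 0 * P +
        (sign 1 * (- u * (sign 0 * (- u * Q) + sign k * (- u * ((- u) ^ k * rest))))
        + sign (suc k) * (- u * (sign 0 * (- u * ((- u) ^ k * rest)) + sign k * (- u * (pathDet k * rest)))))
        ≈⟨ simplify (x 0) u P Q rest (sign k) ((- u) ^ k) (pathDet k) ⟩
      x 0 * P - u ^ 2 * Q - u ^ 2 * pathDet k * (sign k * sign k) * rest
        - (u ^ 2 * (sign k * (- u) ^ k) + u ^ 2 * (sign k * (- u) ^ k)) * rest
        ≈⟨ +-cong (+-congˡ (-‿cong (*-congʳ (trans (*-congˡ (sign-sign k)) (*-identityʳ _)))))
                  (-‿cong (*-congʳ (+-cong power power))) ⟩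
      x 0 * P - u ^ 2 * Q - u ^ 2 * pathDet k * rest - (u ^ (2 +ℕ k) + u ^ (2 +ℕ k)) * rest ∎
      where
      S = symmetric x f
      rest = D n (symmetric (λ i → x (suc (suc k) +ℕ i)) (λ i → f (suc (suc k) +ℕ i)))
      P = D (suc (k +ℕ n)) (symmetric (x ∘ suc) (f ∘ suc))
      Q = D (k +ℕ n) (symmetric (x ∘ suc ∘ suc) (f ∘ suc ∘ suc))

      k<n : k < suc (k +ℕ n)
      k<n = s≤s (ℕ.m≤m+n k n)

      minor : ℕ → Carrier
      minor j = D (suc (k +ℕ n)) λ r c → S (suc r) (skip (suc j) c)

      minor-expansion : ∀ p → let d = λ i → D (k +ℕ n) λ r c → S (suc (skip i r)) (suc (skip p c)) in
        minor p ≈ sign 0 * (- u * d 0) + sign k * (- u * d k)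
      minor-expansion p = trans
        (column-expansion (k +ℕ n) λ r c → S (suc r) (skip (suc p) c))
        (cofactor-sum₂ sign (f 0) (λ i → D (k +ℕ n) λ r c → S (suc (skip i r)) (suc (skip p c))) z<s k<n link)

      minor₁ : minor 0 ≈ sign 0 * (- u * Q) + sign k * (- u * ((- u) ^ k * rest))
      minor₁ = trans (minor-expansion 0) (+-congˡ (*-congˡ (*-congˡ (D-path-shifted k n path))))

      minorₖ : minor k ≈ sign 0 * (- u * ((- u) ^ k * rest)) + sign k * (- u * (pathDet k * rest))
      minorₖ = trans (minor-expansion k)
        (+-cong (*-congˡ (*-congˡ (D-path-shiftedᵀ k n path))) (*-congˡ (*-congˡ (D-path-skip k n path))))

      simplify : ∀ x u p q r s t K →
        x * p + (- 1# * 1# * (- u * (1# * (- u * q) + s * (- u * (t * r))))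
          + - 1# * s * (- u * (1# * (- u * (t * r)) + s * (- u * (K * r)))))
        ≈ x * p - u ^ 2 * q - u ^ 2 * K * (s * s) * r - (u ^ 2 * (s * t) + u ^ 2 * (s * t)) * r
      simplify = solve 8 (λ x u p q r s t K →
        x :* p :+ (:- :1 :* :1 :* (:- u :* (:1 :* (:- u :* q) :+ s :* (:- u :* (t :* r))))
          :+ :- :1 :* s :* (:- u :* (:1 :* (:- u :* (t :* r)) :+ s :* (:- u :* (K :* r)))))
        := x :* p :- u :^ 2 :* q :- u :^ 2 :* K :* (s :* s) :* r :- (u :^ 2 :* (s :* t) :+ u :^ 2 :* (s :* t)) :* r) refl

      power : u ^ 2 * (sign k * (- u) ^ k) ≈ u ^ (2 +ℕ k)
      power = trans (*-congˡ (sign-power k))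
        (solve 2 (λ u p → u :^ 2 :* p := u :* (u :* p)) refl u (u ^ k))

    -- The two first integrals of the recurrence y = (1 + u²) y′ − u² y″.
    D-chain : ∀ t n {x f} → IsPath t x f →
      let X  = D (suc t +ℕ n) (symmetric x f)
          Y  = D (t +ℕ n) (symmetric (x ∘ suc) (f ∘ suc))
          X′ = D (suc n) (symmetric (λ i → x (t +ℕ i)) (λ i → f (t +ℕ i)))
          Y′ = D n (symmetric (λ i → x (suc t +ℕ i)) (λ i → f (suc t +ℕ i)))
      in (X - u ^ 2 * Y ≈ X′ - u ^ 2 * Y′) ∧ (X - Y ≈ (u ^ t) ^ 2 * (X′ - Y′))
    D-chain zero    n {x} {f} path = refl ,
      solve 1 (λ z → z := :1 :^ 2 :* z) refl _
    D-chain (suc t) n {x} {f} path =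
      (begin
        X - u ^ 2 * Y                        ≈⟨ +-congʳ step ⟩
        (1# + u ^ 2) * Y - u ^ 2 * Z - u ^ 2 * Y
          ≈⟨ solve 3 (λ u y z → (:1 :+ u :^ 2) :* y :- u :^ 2 :* z :- u :^ 2 :* y := y :- u :^ 2 :* z) refl u Y Z ⟩
        Y - u ^ 2 * Z                        ≈⟨ proj₁ ih ⟩
        _                                    ∎) ,
      (begin
        X - Y                                ≈⟨ +-congʳ step ⟩
        (1# + u ^ 2) * Y - u ^ 2 * Z - Y
          ≈⟨ solve 3 (λ u y z → (:1 :+ u :^ 2) :* y :- u :^ 2 :* z :- y := u :^ 2 :* (y :- z)) refl u Y Z ⟩
        u ^ 2 * (Y - Z)                      ≈⟨ *-congˡ (proj₂ ih) ⟩
        u ^ 2 * ((u ^ t) ^ 2 * _)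
          ≈⟨ solve 3 (λ u p z → u :^ 2 :* (p :^ 2 :* z) := (u :* p) :^ 2 :* z) refl u (u ^ t) _ ⟩
        (u ^ suc t) ^ 2 * _                  ∎)
      where
      X = D (suc (suc t) +ℕ n) (symmetric x f)
      Y = D (suc t +ℕ n) (symmetric (x ∘ suc) (f ∘ suc))
      Z = D (t +ℕ n) (symmetric (x ∘ suc ∘ suc) (f ∘ suc ∘ suc))
      ih = D-chain t n (IsPath-tail {x = x} {f} path)
      step : X ≈ (1# + u ^ 2) * Y - u ^ 2 * Z
      step = trans (leading-vertex (t +ℕ n) (symmetric x f) (proj₂ (path 0 z<s)) (proj₂ (path 0 z<s)))
        (+-congʳ (*-congʳ (proj₁ (path 0 z<s))))

-- Counting by sums of indicators

module Counting {c ℓ} (S : Semiring c ℓ) where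
  open Semiring S hiding (zero)
  open Sum S using (sum; sum-cong-≋)
  open Mult S using () renaming (_×_ to _·_; ×-homo-+ to ·-homo-+; ×-congˡ to ·-congˡ)
  open Kronecker S
  open import Relation.Binary.Reasoning.Setoid setoid

  indicator : ∀ {p} {P : Set p} → Dec P → Carrier
  indicator P? = if does P? then 1# else 0#

  indicator-cong : ∀ {p q} {P : Set p} {Q : Set q} (P? : Dec P) (Q? : Dec Q) → P ⇔ Q →
    indicator P? ≈ indicator Q?
  indicator-cong P? Q? P⇔Q = reflexive (≡.cong (if_then 1# else 0#) (does-⇔ P⇔Q P? Q?))

  indicator-× : ∀ {p q} {P : Set p} {Q : Set q} (P? : Dec P) (Q? : Dec Q) →
    indicator (P? ×-dec Q?) ≈ indicator P? * indicator Q?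
  indicator-× (yes _) Q? = sym (*-identityˡ _)
  indicator-× (no  _) Q? = sym (zeroˡ _)

  indicator-⊎ : ∀ {p q} {P : Set p} {Q : Set q} (P? : Dec P) (Q? : Dec Q) → ¬ (P ∧ Q) →
    indicator (P? ⊎-dec Q?) ≈ indicator P? + indicator Q?
  indicator-⊎ (yes p) (yes q) ¬pq = contradiction (p , q) ¬pq
  indicator-⊎ (yes _) (no  _) ¬pq = sym (+-identityʳ _)
  indicator-⊎ (no  _) Q?      ¬pq = sym (+-identityˡ _)

  -- The count is taken in an arbitrary semiring because it is used twice: in the ring for the
  -- degrees on the diagonal, and in ℕ for the rank.
  length-filter-tabulate : ∀ {a p n} {A : Set a} {P : Pred A p} (P? : Decidable P) (g : Fin n → A) →
    length (filter P? (tabulate g)) · 1# ≈ sum λ i → indicator (P? (g i))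
  length-filter-tabulate {n = zero}  P? g = refl
  length-filter-tabulate {n = suc n} P? g with does (P? (g Fin.zero))
  ... | true  = +-congˡ (length-filter-tabulate P? (λ i → g (Fin.suc i)))
  ... | false = trans (length-filter-tabulate P? (λ i → g (Fin.suc i))) (sym (+-identityˡ _))

  length-filter-cartesianProduct : ∀ {a b p m n} {A : Set a} {B : Set b} {P : Pred (A ∧ B) p} (P? : Decidable P)
    (g : Fin m → A) (h : Fin n → B) →
    length (filter P? (cartesianProduct (tabulate g) (tabulate h))) · 1# ≈
      sum λ i → sum λ j → indicator (P? (g i , h j))
  length-filter-cartesianProduct {m = zero}  P? g h = refl
  length-filter-cartesianProduct {m = suc m} P? g h = begin
    length (filter P? (row ++ rest)) · 1#
      ≈⟨ ·-congˡ (≡.trans (≡.cong length (filter-++ P? row rest)) (length-++ (filter P? row))) ⟩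
    (length (filter P? row) +ℕ length (filter P? rest)) · 1#
      ≈⟨ ·-homo-+ 1# (length (filter P? row)) _ ⟩
    length (filter P? row) · 1# + length (filter P? rest) · 1#
      ≈⟨ +-cong
           (trans (·-congˡ (≡.cong (length ∘ filter P?) (map-tabulate h (g Fin.zero ,_))))
                  (length-filter-tabulate P? λ j → (g Fin.zero , h j)))
           (length-filter-cartesianProduct P? (λ i → g (Fin.suc i)) h) ⟩
    _ ∎
    where
    row  = map (g Fin.zero ,_) (tabulate h)
    rest = cartesianProduct (tabulate λ i → g (Fin.suc i)) (tabulate h)

  δ-≡ : ∀ {p q} → p ≡ q → δ p q ≈ 1#
  δ-≡ {p} {q} p≡q = reflexive (≡.cong (if_then 1# else 0#) (dec-true (p ≟ q) p≡q))

  δ-≢ : ∀ {p q} → p ≢ q → δ p q ≈ 0#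
  δ-≢ {p} {q} p≢q = reflexive (≡.cong (if_then 1# else 0#) (dec-false (p ≟ q) p≢q))

  δ-sym : ∀ p q → δ p q ≡ δ q p
  δ-sym zero    zero    = ≡.refl
  δ-sym zero    (suc q) = ≡.refl
  δ-sym (suc p) zero    = ≡.refl
  δ-sym (suc p) (suc q) = δ-sym p q

  δ-+ : ∀ i p q → δ (i +ℕ p) (i +ℕ q) ≡ δ p q
  δ-+ zero    p q = ≡.refl
  δ-+ (suc i) p q = δ-+ i p q

  ∑<-δ-one : ∀ {n p} → p < n → ∑< n (δ p) ≈ 1#
  ∑<-δ-one {n} {p} p<n = trans (∑<-cong n λ j → sym (*-identityʳ _)) (∑<-δ (λ _ → 1#) p<n)

  ∑<-δ-outside : ∀ {n p} → n ≤ p → ∑< n (δ p) ≈ 0#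
  ∑<-δ-outside {zero}  _ = ∑<-zero _
  ∑<-δ-outside {suc n} {suc p} (s≤s n≤p) = trans (∑<-suc n _)
    (trans (+-identityˡ _) (∑<-δ-outside n≤p))

  -- The extra summand replaces a subtraction, which a semiring does not offer: it fills the gap at
  -- `b`, the only vertex without a successor.
  ∑<-δ-next : ∀ {b i} → i ≤ b → ∑< (suc b) (δ (suc i)) + δ b i ≈ 1#
  ∑<-δ-next {b} {i} i≤b with ℕ.m≤n⇒m<n∨m≡n i≤b
  ... | inj₁ i<b    = trans (+-cong (∑<-δ-one (s<s i<b)) (δ-≢ (ℕ.<⇒≢ i<b ∘ ≡.sym))) (+-identityʳ _)
  ... | inj₂ ≡.refl = trans (+-cong (∑<-δ-outside {suc b} {suc b} ℕ.≤-refl) (δ-≡ {b} ≡.refl)) (+-identityˡ _)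

  ∑<-δ-previous : ∀ {n} i → i < n → ∑< n (λ j → δ (suc j) i) + δ 0 i ≈ 1#
  ∑<-δ-previous {n} zero    _   = trans (+-congʳ (∑<-0 n λ _ → refl)) (+-identityˡ _)
  ∑<-δ-previous {n} (suc i) i<n = trans (+-identityʳ _)
    (trans (∑<-cong n λ j → reflexive (δ-sym j i)) (∑<-δ-one (ℕ.<-trans (ℕ.n<1+n i) i<n)))

-- Edges, degrees and rank of the handcuff graph

-- Here k = m − 1 and h = n − 1; the cycles are joined to the path at the vertices k and a, and the
-- last vertex is b.
module Handcuff (k h l : ℕ) (m>2 : suc k > 2) (n>2 : suc h > 2) where
  1<k : 1 < k
  1<k = ℕ.s≤s⁻¹ m>2

  1<h : 1 < h
  1<h = ℕ.s≤s⁻¹ n>2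

  a b N : ℕ
  a = k +ℕ l
  b = a +ℕ h
  N = a +ℕ suc h

  N≡1+b : N ≡ suc b
  N≡1+b = ℕ.+-suc a h

  open Graph (handcuffGraph (suc k) (suc h) l m>2 n>2)

  infix 4 _↗_ _↗?_

  -- The edges, oriented from the smaller endpoint to the larger one.
  _↗_ : ℕ → ℕ → Set
  i ↗ j = suc i ≡ j ⊎ (0 ≡ i ∧ k ≡ j) ⊎ (a ≡ i ∧ b ≡ j)

  _↗?_ : ∀ i j → Dec (i ↗ j)
  i ↗? j = (suc i ≟ j) ⊎-dec ((0 ≟ i) ×-dec (k ≟ j)) ⊎-dec ((a ≟ i) ×-dec (b ≟ j))

  0<k : 0 < k
  0<k = ℕ.<-trans z<s 1<k

  0<a : 0 < a
  0<a = ℕ.<-≤-trans 0<k (ℕ.m≤m+n k l)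

  1+a<b : suc a < b
  1+a<b = ≡.subst (_< b) (ℕ.+-comm a 1) (ℕ.+-monoʳ-< a 1<h)

  ↗⇒< : ∀ {i j} → i ↗ j → i < j
  ↗⇒< (inj₁ ≡.refl)                     = ℕ.n<1+n _
  ↗⇒< (inj₂ (inj₁ (≡.refl , ≡.refl)))   = 0<k
  ↗⇒< (inj₂ (inj₂ (≡.refl , ≡.refl)))   = ℕ.<-trans (ℕ.n<1+n a) 1+a<b

  edge⇒↗ : ∀ {x y} → HandcuffEdge (suc k) (suc h) l x y → x ↗ y ⊎ y ↗ x
  edge⇒↗ (inj₁ (inj₁ (_ , _ , y≡1+x)))        = inj₁ (inj₁ (≡.sym y≡1+x))
  edge⇒↗ (inj₁ (inj₂ (x≡k , y≡0)))            = inj₂ (inj₂ (inj₁ (≡.sym y≡0 , ≡.sym x≡k)))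
  edge⇒↗ (inj₂ (inj₁ (_ , _ , y≡1+x)))        = inj₁ (inj₁ (≡.sym y≡1+x))
  edge⇒↗ (inj₂ (inj₂ (inj₁ (_ , _ , y≡1+x)))) = inj₁ (inj₁ (≡.sym y≡1+x))
  edge⇒↗ (inj₂ (inj₂ (inj₂ (x≡b , y≡a))))     = inj₂ (inj₂ (inj₂ (≡.sym y≡a , ≡.sym x≡b)))

  ~⇒↗ : ∀ {i j} → i ~ j → toℕ i ↗ toℕ j ⊎ toℕ j ↗ toℕ i
  ~⇒↗ (inj₁ e) = edge⇒↗ e
  ~⇒↗ (inj₂ e) = swap (edge⇒↗ e)

  ↗⇒~ : ∀ {i j} → toℕ i ↗ toℕ j → i ~ j
  ↗⇒~ {i} {j} (inj₁ 1+i≡j)               = handcuff-consecutive m>2 n>2 i j (≡.sym 1+i≡j)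
  ↗⇒~ (inj₂ (inj₁ (0≡i , k≡j))) = inj₂ (inj₁ (inj₂ (≡.sym k≡j , ≡.sym 0≡i)))
  ↗⇒~ (inj₂ (inj₂ (a≡i , b≡j))) = inj₂ (inj₂ (inj₂ (inj₂ (≡.sym b≡j , ≡.sym a≡i))))

  ~⇔↗ : ∀ {i j} → i ~ j ⇔ (toℕ i ↗ toℕ j ⊎ toℕ j ↗ toℕ i)
  ~⇔↗ = mk⇔ ~⇒↗ [ ↗⇒~ , (λ e → ~-sym (↗⇒~ e)) ]′

  <⇒~⇒↗ : ∀ {i j} → toℕ i < toℕ j → i ~ j → toℕ i ↗ toℕ j
  <⇒~⇒↗ i<j i~j with ~⇒↗ i~j
  ... | inj₁ i↗j = i↗j
  ... | inj₂ j↗i = contradiction (↗⇒< j↗i) (ℕ.<-asym i<j)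

  module Weights {c ℓ} (S : Semiring c ℓ) where
    open Semiring S hiding (zero)
    open Sum S using (sum; sum-cong-≋)
    open Mult S using () renaming (_×_ to _·_)
    open Kronecker S
    open Counting S
    open import Relation.Binary.Reasoning.Setoid setoid
    open CommutativeMonoidSolver +-commutativeMonoid using (solve; _⊜_; _⊕_)

    weight : ℕ → ℕ → Carrier
    weight i j = δ (suc i) j + (δ 0 i * δ k j + δ a i * δ b j)

    indicator-↗ : ∀ i j → indicator (i ↗? j) ≈ weight i j
    indicator-↗ i j = begin
      indicator (i ↗? j)
        ≈⟨ indicator-⊎ (suc i ≟ j) (((0 ≟ i) ×-dec (k ≟ j)) ⊎-dec ((a ≟ i) ×-dec (b ≟ j))) path∧chord ⟩
      δ (suc i) j + indicator (((0 ≟ i) ×-dec (k ≟ j)) ⊎-dec ((a ≟ i) ×-dec (b ≟ j)))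
        ≈⟨ +-congˡ (indicator-⊎ ((0 ≟ i) ×-dec (k ≟ j)) ((a ≟ i) ×-dec (b ≟ j)) chord∧chord) ⟩
      δ (suc i) j + (indicator ((0 ≟ i) ×-dec (k ≟ j)) + indicator ((a ≟ i) ×-dec (b ≟ j)))
        ≈⟨ +-congˡ (+-cong (indicator-× (0 ≟ i) (k ≟ j)) (indicator-× (a ≟ i) (b ≟ j))) ⟩
      weight i j ∎
      where
      -- Cycles of length at least 3 are what keeps a chord from coinciding with a path edge, so
      -- that the sum of deltas counts no edge twice.
      path∧chord : ¬ (suc i ≡ j ∧ ((0 ≡ i ∧ k ≡ j) ⊎ (a ≡ i ∧ b ≡ j)))
      path∧chord (1+i≡j , inj₁ (≡.refl , k≡j)) = ℕ.<⇒≢ 1<k (≡.trans 1+i≡j (≡.sym k≡j))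
      path∧chord (1+i≡j , inj₂ (≡.refl , b≡j)) = ℕ.<⇒≢ 1+a<b (≡.trans 1+i≡j (≡.sym b≡j))
      chord∧chord : ¬ ((0 ≡ i ∧ k ≡ j) ∧ (a ≡ i ∧ b ≡ j))
      chord∧chord ((0≡i , _) , (a≡i , _)) = ℕ.<⇒≢ 0<a (≡.trans 0≡i (≡.sym a≡i))

    indicator-~ : ∀ i j → indicator (i ~? j) ≈ weight (toℕ i) (toℕ j) + weight (toℕ j) (toℕ i)
    indicator-~ i j = begin
      indicator (i ~? j)
        ≈⟨ indicator-cong (i ~? j) ((toℕ i ↗? toℕ j) ⊎-dec (toℕ j ↗? toℕ i)) ~⇔↗ ⟩
      indicator ((toℕ i ↗? toℕ j) ⊎-dec (toℕ j ↗? toℕ i))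
        ≈⟨ indicator-⊎ (toℕ i ↗? toℕ j) (toℕ j ↗? toℕ i) (λ (i↗j , j↗i) → ℕ.<-asym (↗⇒< i↗j) (↗⇒< j↗i)) ⟩
      indicator (toℕ i ↗? toℕ j) + indicator (toℕ j ↗? toℕ i)
        ≈⟨ +-cong (indicator-↗ (toℕ i) (toℕ j)) (indicator-↗ (toℕ j) (toℕ i)) ⟩
      weight (toℕ i) (toℕ j) + weight (toℕ j) (toℕ i) ∎

    ≤b⇒<N : ∀ {i} → i ≤ b → i < N
    ≤b⇒<N {i} i≤b = ≡.subst (i <_) (≡.sym N≡1+b) (s≤s i≤b)

    weight-rowSum : ∀ i → ∑< N (weight i) ≈ ∑< N (δ (suc i)) + (δ 0 i + δ a i)
    weight-rowSum i = begin
      ∑< N (weight i)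
        ≈⟨ ∑<-+ N _ _ ⟩
      ∑< N (δ (suc i)) + ∑< N (λ j → δ 0 i * δ k j + δ a i * δ b j)
        ≈⟨ +-congˡ (∑<-+ N _ _) ⟩
      ∑< N (δ (suc i)) + (∑< N (λ j → δ 0 i * δ k j) + ∑< N (λ j → δ a i * δ b j))
        ≈⟨ +-congˡ (+-cong (*-∑< N _ _) (*-∑< N _ _)) ⟨
      ∑< N (δ (suc i)) + (δ 0 i * ∑< N (δ k) + δ a i * ∑< N (δ b))
        ≈⟨ +-congˡ (+-cong (*-congˡ (∑<-δ-one (≤b⇒<N k≤b))) (*-congˡ (∑<-δ-one (≤b⇒<N {b} ℕ.≤-refl)))) ⟩
      ∑< N (δ (suc i)) + (δ 0 i * 1# + δ a i * 1#)
        ≈⟨ +-congˡ (+-cong (*-identityʳ _) (*-identityʳ _)) ⟩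
      ∑< N (δ (suc i)) + (δ 0 i + δ a i) ∎
      where
      k≤b : k ≤ b
      k≤b = ℕ.≤-trans (ℕ.m≤m+n k l) (ℕ.m≤m+n a h)

    weight-columnSum : ∀ i → ∑< N (λ j → weight j i) ≈ ∑< N (λ j → δ (suc j) i) + (δ k i + δ b i)
    weight-columnSum i = begin
      ∑< N (λ j → weight j i)
        ≈⟨ ∑<-+ N _ _ ⟩
      ∑< N (λ j → δ (suc j) i) + ∑< N (λ j → δ 0 j * δ k i + δ a j * δ b i)
        ≈⟨ +-congˡ (∑<-+ N _ _) ⟩
      ∑< N (λ j → δ (suc j) i) + (∑< N (λ j → δ 0 j * δ k i) + ∑< N (λ j → δ a j * δ b i))
        ≈⟨ +-congˡ (+-cong (∑<-δ (λ _ → δ k i) (≤b⇒<N z≤n)) (∑<-δ (λ _ → δ b i) (≤b⇒<N (ℕ.m≤m+n a h)))) ⟩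
      ∑< N (λ j → δ (suc j) i) + (δ k i + δ b i) ∎

    ∑<-δ-nextᴺ : ∀ i → i < N → ∑< N (δ (suc i)) + δ b i ≈ 1#
    ∑<-δ-nextᴺ i i<N = begin
      ∑< N (δ (suc i)) + δ b i        ≡⟨ ≡.cong (λ n → ∑< n (δ (suc i)) + δ b i) N≡1+b ⟩
      ∑< (suc b) (δ (suc i)) + δ b i  ≈⟨ ∑<-δ-next (ℕ.≤-pred (≡.subst (i <_) N≡1+b i<N)) ⟩
      1#                              ∎

    -- On the Hamiltonian path `b` lacks a successor and 0 lacks a predecessor. The chord ends at
    -- `b` and 0 make up for exactly these, so every vertex gets 2 and the other chord ends, `k` and
    -- `a`, get one more.
    degree-weight : ∀ i → degree i · 1# ≈ 1# + 1# + (δ k (toℕ i) + δ a (toℕ i))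
    degree-weight i = begin
      degree i · 1#
        ≈⟨ length-filter-tabulate {n = N} (i ~?_) id ⟩
      sum {N} (λ j → indicator (i ~? j))
        ≈⟨ sum-cong-≋ {N} (indicator-~ i) ⟩
      sum {N} (λ j → weight (toℕ i) (toℕ j) + weight (toℕ j) (toℕ i))
        ≈⟨ ∑<≈sum N (λ j → weight (toℕ i) j + weight j (toℕ i)) ⟨
      ∑< N (λ j → weight (toℕ i) j + weight j (toℕ i))
        ≈⟨ ∑<-+ N _ _ ⟩
      ∑< N (weight (toℕ i)) + ∑< N (λ j → weight j (toℕ i))
        ≈⟨ +-cong (weight-rowSum (toℕ i)) (weight-columnSum (toℕ i)) ⟩
      (∑< N (δ (suc (toℕ i))) + (δ 0 (toℕ i) + δ a (toℕ i))) + (∑< N (λ j → δ (suc j) (toℕ i)) + (δ k (toℕ i) + δ b (toℕ i)))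
        ≈⟨ solve 6 (λ r z a c k b → (r ⊕ (z ⊕ a)) ⊕ (c ⊕ (k ⊕ b)) ⊜ ((r ⊕ b) ⊕ (c ⊕ z)) ⊕ (k ⊕ a)) refl _ _ _ _ _ _ ⟩
      (∑< N (δ (suc (toℕ i))) + δ b (toℕ i)) + (∑< N (λ j → δ (suc j) (toℕ i)) + δ 0 (toℕ i)) + (δ k (toℕ i) + δ a (toℕ i))
        ≈⟨ +-congʳ (+-cong (∑<-δ-nextᴺ (toℕ i) (Fin.toℕ<n i)) (∑<-δ-previous (toℕ i) (Fin.toℕ<n i))) ⟩
      1# + 1# + (δ k (toℕ i) + δ a (toℕ i)) ∎

    -- The 1 on the left stands for the missing successor of `b`. Rewritten as `∑< N (δ b)`, it
    -- completes the N - 1 path edges to one per vertex, and the two chords give the remaining 2.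
    edges-weight : length edges · 1# + 1# ≈ 1# + 1# + ∑< N (λ _ → 1#)
    edges-weight = begin
      length edges · 1# + 1#
        ≈⟨ +-congʳ (length-filter-cartesianProduct {m = N} {N} (λ (i , j) → (i Fin.<? j) ×-dec (i ~? j)) id id) ⟩
      sum {N} (λ i → sum {N} λ j → indicator ((i Fin.<? j) ×-dec (i ~? j))) + 1#
        ≈⟨ +-congʳ (sum-cong-≋ {N} λ i → sum-cong-≋ {N} λ j → trans
             (indicator-cong ((i Fin.<? j) ×-dec (i ~? j)) (toℕ i ↗? toℕ j)
               (mk⇔ (λ (i<j , i~j) → <⇒~⇒↗ i<j i~j) (λ i↗j → ↗⇒< i↗j , ↗⇒~ i↗j)))
             (indicator-↗ (toℕ i) (toℕ j))) ⟩
      sum {N} (λ i → sum {N} λ j → weight (toℕ i) (toℕ j)) + 1#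
        ≈⟨ +-congʳ (sum-cong-≋ {N} λ i → trans (sym (∑<≈sum N (weight (toℕ i)))) (weight-rowSum (toℕ i))) ⟩
      sum {N} (λ i → next (toℕ i) + (δ 0 (toℕ i) + δ a (toℕ i))) + 1#
        ≈⟨ +-congʳ (∑<≈sum N (λ i → next i + (δ 0 i + δ a i))) ⟨
      ∑< N (λ i → next i + (δ 0 i + δ a i)) + 1#
        ≈⟨ +-congʳ (trans (∑<-+ N _ _) (+-congˡ (∑<-+ N _ _))) ⟩
      ∑< N next + (∑< N (δ 0) + ∑< N (δ a)) + 1#
        ≈⟨ +-cong (+-congˡ (+-cong (∑<-δ-one (≤b⇒<N z≤n)) (∑<-δ-one (≤b⇒<N (ℕ.m≤m+n a h)))))
                  (sym (∑<-δ-one (≤b⇒<N {b} ℕ.≤-refl))) ⟩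
      ∑< N next + (1# + 1#) + ∑< N (δ b)
        ≈⟨ solve 3 (λ x y z → (x ⊕ y) ⊕ z ⊜ y ⊕ (x ⊕ z)) refl _ _ _ ⟩
      1# + 1# + (∑< N next + ∑< N (δ b))
        ≈⟨ +-congˡ (∑<-+ N _ _) ⟨
      1# + 1# + ∑< N (λ i → next i + δ b i)
        ≈⟨ +-congˡ (trans (∑<≈sum N (λ i → next i + δ b i)) (sum-cong-≋ {N} λ i → ∑<-δ-nextᴺ (toℕ i) (Fin.toℕ<n i))) ⟩
      1# + 1# + sum {N} (λ _ → 1#)
        ≈⟨ +-congˡ (∑<≈sum N (λ _ → 1#)) ⟨
      1# + 1# + ∑< N (λ _ → 1#) ∎
      where
      next : ℕ → Carrier
      next i = ∑< N (δ (suc i))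

  -- The edge count is instantiated in ℕ, since an equation in the ring would determine the number
  -- of edges only up to the characteristic.
  rank≡2 : rank ≡ 2
  rank≡2 = ≡.trans (≡.cong (_∸ N) edges+1≡2+N) (ℕ.m+n∸n≡m 2 N)
    where
    open Sum ℕ.+-*-semiring using (sum-replicate)
    open Kronecker ℕ.+-*-semiring using (∑<≈sum)
    open Mult ℕ.+-*-semiring using () renaming (_×_ to _·_)
    open Weights ℕ.+-*-semiring

    ·1 : ∀ n → n · 1 ≡ n
    ·1 zero    = ≡.refl
    ·1 (suc n) = ≡.cong suc (·1 n)

    edges+1≡2+N : length edges +ℕ 1 ≡ 2 +ℕ N
    edges+1≡2+N = ≡.trans (≡.cong (_+ℕ 1) (≡.sym (·1 (length edges))))
      (≡.trans edges-weight (≡.cong (2 +ℕ_)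
        (≡.trans (∑<≈sum N (λ _ → 1)) (≡.trans (sum-replicate N) (·1 N)))))

-- The matrix of the handcuff graph

module HandcuffDeterminant {c ℓ} (R : CommutativeRing c ℓ) (k′ h′ l′ : ℕ)
  (m>2 : suc (suc k′) > 2) (n>2 : suc (suc h′) > 2) (u : CommutativeRing.Carrier R) where
  open CommutativeRing R hiding (zero)
  open Exp semiring using (_^_; ^-homo-*; ^-assocʳ; ^-congʳ)
  open Mult semiring using () renaming (_×_ to _·_)
  open Kronecker semiring using (δ)
  open Counting semiring
  open Determinant R
  open Handcuff (suc k′) (suc h′) (suc l′) m>2 n>2
  open Weights semiring
  open Graph (handcuffGraph (suc (suc k′)) (suc (suc h′)) (suc l′) m>2 n>2)
  open IntegerCoefficients R using (solve; :0; :1; _:=_; _:+_; _:*_; _:-_; :-_; _:^_; _:×_)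
  open import Relation.Binary.Reasoning.Setoid setoid

  private
    k h l : ℕ
    k = suc k′
    h = suc h′
    l = suc l′

  x : ℕ → Carrier
  x i = 1# + (1# + (δ k i + δ a i)) * u ^ 2

  f : ℕ → ℕ → Carrier
  f i d = - u * weight i (suc (i +ℕ d))

  M : Matrix R N
  M i j = (identity R i j - adjacency R graph i j * u) + 𝒬 R graph i j * (u ^ 2)
    where graph = handcuffGraph (suc (suc k′)) (suc (suc h′)) (suc l′) m>2 n>2

  offDiagonal-entry : ∀ i j → i ≢ j → M i j ≈ - u * indicator (i ~? j)
  offDiagonal-entry i j i≢j = begin
    M i j
      ≈⟨ +-cong (+-congʳ (off 1#)) (*-congʳ (+-cong (off (degree i · 1#)) (-‿cong (off 1#)))) ⟩
    (0# - indicator (i ~? j) * u) + (0# - 0#) * u ^ 2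
      ≈⟨ solve 2 (λ e u → (:0 :- e :* u) :+ (:0 :- :0) :* u :^ 2 := :- u :* e) refl (indicator (i ~? j)) u ⟩
    - u * indicator (i ~? j) ∎
    where
    off : ∀ z → (if does (i Fin.≟ j) then z else 0#) ≈ 0#
    off z = reflexive (≡.cong (if_then z else 0#) (dec-false (i Fin.≟ j) i≢j))

  diagonal-entry : ∀ i → M i i ≈ x (toℕ i)
  diagonal-entry i = begin
    M i i
      ≈⟨ +-cong (+-cong (on 1#) (-‿cong (*-congʳ (reflexive (≡.cong (if_then 1# else 0#) (dec-false (i ~? i) (~-irrefl {i})))))))
                (*-congʳ (+-cong (trans (on (degree i · 1#)) (degree-weight i)) (-‿cong (on 1#)))) ⟩
    (1# - 0# * u) + (1# + 1# + (δ k (toℕ i) + δ a (toℕ i)) - 1#) * u ^ 2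
      ≈⟨ solve 2 (λ e u → (:1 :- :0 :* u) :+ (:1 :+ :1 :+ e :- :1) :* u :^ 2
           := :1 :+ (:1 :+ e) :* u :^ 2) refl (δ k (toℕ i) + δ a (toℕ i)) u ⟩
    x (toℕ i) ∎
    where
    on : ∀ z → (if does (i Fin.≟ i) then z else 0#) ≈ z
    on z = reflexive (≡.cong (if_then z else 0#) (dec-true (i Fin.≟ i) ≡.refl))

  upper-entry : ∀ {i j} → i < j → symmetric x f i j ≈ - u * weight i j
  upper-entry {i} {j} i<j = begin
    symmetric x f i j                       ≡⟨ ≡.cong (symmetric x f i) (ℕ.m+[n∸m]≡n i<j) ⟨
    symmetric x f i (suc (i +ℕ (j ∸ suc i)))  ≡⟨ symmetric-upper x f i (j ∸ suc i) ⟩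
    - u * weight i (suc (i +ℕ (j ∸ suc i)))   ≡⟨ ≡.cong (λ z → - u * weight i z) (ℕ.m+[n∸m]≡n i<j) ⟩
    - u * weight i j                        ∎

  entry : ∀ i j → M i j ≈ symmetric x f (toℕ i) (toℕ j)
  entry i j with ℕ.<-cmp (toℕ i) (toℕ j)
  ... | tri< i<j i≢j _ = begin
    M i j                               ≈⟨ offDiagonal-entry i j (i≢j ∘ ≡.cong toℕ) ⟩
    - u * indicator (i ~? j)            ≈⟨ *-congˡ (indicator-cong (i ~? j) (toℕ i ↗? toℕ j) (mk⇔ (<⇒~⇒↗ i<j) ↗⇒~)) ⟩
    - u * indicator (toℕ i ↗? toℕ j)    ≈⟨ *-congˡ (indicator-↗ (toℕ i) (toℕ j)) ⟩
    - u * weight (toℕ i) (toℕ j)        ≈⟨ upper-entry i<j ⟨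
    symmetric x f (toℕ i) (toℕ j)       ∎
  ... | tri> _ i≢j j<i = begin
    M i j                               ≈⟨ offDiagonal-entry i j (i≢j ∘ ≡.cong toℕ) ⟩
    - u * indicator (i ~? j)            ≈⟨ *-congˡ (indicator-cong (i ~? j) (toℕ j ↗? toℕ i)
                                              (mk⇔ (λ i~j → <⇒~⇒↗ j<i (~-sym i~j)) (λ j↗i → ~-sym (↗⇒~ j↗i)))) ⟩
    - u * indicator (toℕ j ↗? toℕ i)    ≈⟨ *-congˡ (indicator-↗ (toℕ j) (toℕ i)) ⟩
    - u * weight (toℕ j) (toℕ i)        ≈⟨ upper-entry j<i ⟨
    symmetric x f (toℕ j) (toℕ i)       ≡⟨ symmetric-sym x f (toℕ j) (toℕ i) ⟩
    symmetric x f (toℕ i) (toℕ j)       ∎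
  ... | tri≈ _ i≡j _ with Fin.toℕ-injective i≡j
  ... | ≡.refl = trans (diagonal-entry i) (reflexive (≡.sym (symmetric-diagonal x f (toℕ i))))

  weight-upper : ∀ i d → weight i (suc (i +ℕ d)) ≈
    δ 0 d + (δ 0 i * δ k (suc (i +ℕ d)) + δ a i * δ b (suc (i +ℕ d)))
  weight-upper i d = +-congʳ (reflexive (≡.trans
    (≡.cong (λ z → δ z (i +ℕ d)) (≡.sym (ℕ.+-identityʳ i))) (δ-+ i 0 d)))

  -- As `f` records links to larger vertices only, the exceptions are the lower chord ends 0 and `a`
  -- and the degree-3 vertices `k` and `a`. The upper chord end `b` needs no exception: it has
  -- degree 2, and its formal link to `b + 1` falls outside the N × N block.
  path-vertex : ∀ i → i ≢ 0 → i ≢ k → i ≢ a → (x i ≈ 1# + u ^ 2) ∧ (∀ d → f i d ≈ - u * δ 0 d)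
  path-vertex i i≢0 i≢k i≢a = x-path , f-path
    where
    x-path : x i ≈ 1# + u ^ 2
    x-path = begin
      1# + (1# + (δ k i + δ a i)) * u ^ 2
        ≈⟨ +-congˡ (*-congʳ (+-congˡ (+-cong (δ-≢ (i≢k ∘ ≡.sym)) (δ-≢ (i≢a ∘ ≡.sym))))) ⟩
      1# + (1# + (0# + 0#)) * u ^ 2
        ≈⟨ solve 1 (λ u → :1 :+ (:1 :+ (:0 :+ :0)) :* u :^ 2 := :1 :+ u :^ 2) refl u ⟩
      1# + u ^ 2 ∎
    f-path : ∀ d → f i d ≈ - u * δ 0 d
    f-path d = *-congˡ (begin
      weight i (suc (i +ℕ d))
        ≈⟨ weight-upper i d ⟩
      δ 0 d + (δ 0 i * δ k (suc (i +ℕ d)) + δ a i * δ b (suc (i +ℕ d)))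
        ≈⟨ +-congˡ (+-cong (trans (*-congʳ (δ-≢ (i≢0 ∘ ≡.sym))) (zeroˡ _)) (trans (*-congʳ (δ-≢ (i≢a ∘ ≡.sym))) (zeroˡ _))) ⟩
      δ 0 d + (0# + 0#)
        ≈⟨ trans (+-congˡ (+-identityʳ _)) (+-identityʳ _) ⟩
      δ 0 d ∎)

  -- The length `suc l′` of the joining path keeps the branch vertices apart, giving two vertices of
  -- degree 3 instead of one of degree 4.
  k<a : k < a
  k<a = ℕ.m<m+n k z<s

  x-first : x 0 ≈ 1# + u ^ 2
  x-first = solve 1 (λ u → :1 :+ (:1 :+ (:0 :+ :0)) :* u :^ 2 := :1 :+ u :^ 2) refl u

  -- Offset `d` means column `d + 1`, so the chord from 0 to `k` appears at offset `k′`.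
  f-first : ∀ d → f 0 d ≈ - u * δ 0 d + - u * δ k′ d
  f-first d = solve 4 (λ u p q r → :- u :* (p :+ (:1 :* q :+ :0 :* r)) := :- u :* p :+ :- u :* q)
    refl u (δ 0 d) (δ k′ d) (δ b (suc d))

  x-k : x k ≈ 1# + (1# + 1#) * u ^ 2
  x-k = begin
    1# + (1# + (δ k k + δ a k)) * u ^ 2
      ≈⟨ +-congˡ (*-congʳ (+-congˡ (+-cong (δ-≡ {k} ≡.refl) (δ-≢ (ℕ.<⇒≢ k<a ∘ ≡.sym))))) ⟩
    1# + (1# + (1# + 0#)) * u ^ 2
      ≈⟨ +-congˡ (*-congʳ (+-congˡ (+-identityʳ _))) ⟩
    1# + (1# + 1#) * u ^ 2 ∎

  f-k : ∀ d → f k d ≈ - u * δ 0 d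
  f-k d = *-congˡ (begin
    weight k (suc (k +ℕ d))
      ≈⟨ weight-upper k d ⟩
    δ 0 d + (0# * δ k (suc (k +ℕ d)) + δ a k * δ b (suc (k +ℕ d)))
      ≈⟨ +-congˡ (+-cong (zeroˡ _) (trans (*-congʳ (δ-≢ (ℕ.<⇒≢ k<a ∘ ≡.sym))) (zeroˡ _))) ⟩
    δ 0 d + (0# + 0#)
      ≈⟨ trans (+-congˡ (+-identityʳ _)) (+-identityʳ _) ⟩
    δ 0 d ∎)

  x-a : x a ≈ 1# + (1# + 1#) * u ^ 2
  x-a = begin
    1# + (1# + (δ k a + δ a a)) * u ^ 2
      ≈⟨ +-congˡ (*-congʳ (+-congˡ (+-cong (δ-≢ (ℕ.<⇒≢ k<a)) (δ-≡ {a} ≡.refl)))) ⟩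
    1# + (1# + (0# + 1#)) * u ^ 2
      ≈⟨ +-congˡ (*-congʳ (+-congˡ (+-identityˡ _))) ⟩
    1# + (1# + 1#) * u ^ 2 ∎

  f-a : ∀ d → f a d ≈ - u * δ 0 d + - u * δ h′ d
  f-a d = begin
    - u * weight a (suc (a +ℕ d))
      ≈⟨ *-congˡ (weight-upper a d) ⟩
    - u * (δ 0 d + (0# * δ k (suc (a +ℕ d)) + δ a a * δ b (suc (a +ℕ d))))
      ≈⟨ *-congˡ (+-congˡ (+-congˡ (*-cong (δ-≡ {a} ≡.refl) (reflexive (≡.trans
           (≡.cong (δ b) (≡.sym (ℕ.+-suc a d))) (δ-+ a h (suc d))))))) ⟩
    - u * (δ 0 d + (0# * δ k (suc (a +ℕ d)) + 1# * δ h′ d))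
      ≈⟨ solve 4 (λ u p q r → :- u :* (p :+ (:0 :* r :+ :1 :* q)) := :- u :* p :+ :- u :* q)
           refl u (δ 0 d) (δ h′ d) (δ k (suc (a +ℕ d))) ⟩
    - u * δ 0 d + - u * δ h′ d ∎

  a≡ : a ≡ suc (suc (k′ +ℕ l′))
  a≡ = ≡.cong suc (ℕ.+-suc k′ l′)

  k≢ : ∀ z → suc (suc (k′ +ℕ z)) ≢ k
  k≢ z eq = ℕ.<⇒≢ (s<s (s≤s (ℕ.m≤m+n k′ z))) (≡.sym eq)

  between : ∀ z → z < l′ → (x (suc (suc (k′ +ℕ z))) ≈ 1# + u ^ 2) ∧ (∀ d → f (suc (suc (k′ +ℕ z))) d ≈ - u * δ 0 d)
  between z z<l = path-vertex _ (λ ()) (k≢ z) λ eq →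
    ℕ.<⇒≢ (s<s (s<s (ℕ.+-monoʳ-< k′ z<l))) (≡.trans eq a≡)

  beyond : ∀ z → l′ < z → (x (suc (suc (k′ +ℕ z))) ≈ 1# + u ^ 2) ∧ (∀ d → f (suc (suc (k′ +ℕ z))) d ≈ - u * δ 0 d)
  beyond z l<z = path-vertex _ (λ ()) (k≢ z) λ eq →
    ℕ.<⇒≢ (s<s (s<s (ℕ.+-monoʳ-< k′ l<z))) (≡.sym (≡.trans eq a≡))

  -- Elimination along the first cycle, the joining path and the second cycle

  module Elimination where
    r : ℕ
    r = l′ +ℕ h

    v w : Carrier
    v = u ^ suc k
    w = u ^ suc h

    x₂ x₃ : ℕ → Carrier
    x₂ i = x (suc (suc (k′ +ℕ i)))
    x₃ i = x₂ (l′ +ℕ i)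

    f₂ f₃ : ℕ → ℕ → Carrier
    f₂ i = f (suc (suc (k′ +ℕ i)))
    f₃ i = f₂ (l′ +ℕ i)

    -- Principal minors on the vertices ≥ 0, 1, 2, k, k + 1, k + 2, a, a + 1 respectively.
    Z P Q Pₖ X Y A B : Carrier
    Z  = D (suc (suc (k′ +ℕ suc r))) (symmetric x f)
    P  = D (suc (k′ +ℕ suc r)) (symmetric (x ∘ suc) (f ∘ suc))
    Q  = D (k′ +ℕ suc r) (symmetric (x ∘ suc ∘ suc) (f ∘ suc ∘ suc))
    Pₖ = D (suc (suc r)) (symmetric (λ i → x (suc (k′ +ℕ i))) (λ i → f (suc (k′ +ℕ i))))
    X  = D (suc r) (symmetric x₂ f₂)
    Y  = D r (symmetric (x₂ ∘ suc) (f₂ ∘ suc))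
    A  = D (suc h) (symmetric x₃ f₃)
    B  = D h (symmetric (λ i → x₂ (suc l′ +ℕ i)) (λ i → f₂ (suc l′ +ℕ i)))

    path₁ : IsPath u k′ (x ∘ suc) (f ∘ suc)
    path₁ i i<k = path-vertex (suc i) (λ ()) (ℕ.<⇒≢ (s<s i<k)) (ℕ.<⇒≢ (ℕ.<-trans (s<s i<k) k<a))

    path₂ : IsPath u l′ x₂ f₂
    path₂ i i<l = between i i<l

    path₃ : ∀ t → IsPath u t (x₃ ∘ suc) (f₃ ∘ suc)
    path₃ t i _ = beyond (l′ +ℕ suc i) (ℕ.m<m+n l′ z<s)

    Z-cycle : Z ≈ (1# + u ^ 2) * P - u ^ 2 * Q - u ^ 2 * pathDet u k′ * X - (v + v) * X
    Z-cycle = trans (D-cycle u k′ (suc r) path₁ f-first) (+-congʳ (+-congʳ (+-congʳ (*-congʳ x-first))))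

    P-chain : (P - u ^ 2 * Q ≈ Pₖ - u ^ 2 * X) ∧ (P - Q ≈ (u ^ k′) ^ 2 * (Pₖ - X))
    P-chain = D-chain u k′ (suc r) path₁

    -- At the degree-3 vertex `k` the coefficient is 1 + 2u², so the first integrals do not pass
    -- through it: Pₖ exceeds the value (1 + u²) X - u² Y of a path step by u² X.
    Pₖ-vertex : Pₖ ≈ (1# + (1# + 1#) * u ^ 2) * X - u ^ 2 * Y
    Pₖ-vertex = begin
      Pₖ
        ≈⟨ leading-vertex u r _ (λ d → link d) (λ d → link d) ⟩
      x (suc (k′ +ℕ 0)) * D (suc r) (symmetric (λ i → x (suc (k′ +ℕ suc i))) (λ i → f (suc (k′ +ℕ suc i))))
        - u ^ 2 * D r (symmetric (λ i → x (suc (k′ +ℕ suc (suc i)))) (λ i → f (suc (k′ +ℕ suc (suc i)))))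
        ≈⟨ +-cong
             (*-cong (trans (reflexive (≡.cong (x ∘ suc) (ℕ.+-identityʳ k′))) x-k)
               (D-cong (suc r) (symmetric-cong (λ i → cong-x (ℕ.+-suc k′ i)) (λ i → cong-f (ℕ.+-suc k′ i)))))
             (-‿cong (*-congˡ
               (D-cong r (symmetric-cong (λ i → cong-x (ℕ.+-suc k′ (suc i))) (λ i → cong-f (ℕ.+-suc k′ (suc i))))))) ⟩
      (1# + (1# + 1#) * u ^ 2) * X - u ^ 2 * Y ∎
      where
      link : ∀ d → f (suc (k′ +ℕ 0)) d ≈ - u * δ 0 d
      link d = trans (reflexive (≡.cong (λ z → f (suc z) d) (ℕ.+-identityʳ k′))) (f-k d)
      cong-x : ∀ {i j} → i ≡ j → x (suc i) ≈ x (suc j)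
      cong-x i≡j = reflexive (≡.cong (x ∘ suc) i≡j)
      cong-f : ∀ {i j} → i ≡ j → ∀ d → f (suc i) d ≈ f (suc j) d
      cong-f i≡j d = reflexive (≡.cong (λ z → f (suc z) d) i≡j)

    X-chain : (X - u ^ 2 * Y ≈ A - u ^ 2 * B) ∧ (X - Y ≈ (u ^ l′) ^ 2 * (A - B))
    X-chain = D-chain u l′ h path₂

    B-path : B ≈ pathDet u h
    B-path = D-path u h λ i _ → beyond (suc l′ +ℕ i) (s≤s (ℕ.m≤m+n l′ i))

    -- Nothing follows this cycle, so the `rest` in `D-cycle` is the empty determinant 1. The
    -- coefficient 1 + 2u² at `a` provides one u² for each of the two back-and-forth terms, and the
    -- consecutive path determinants then differ by a single power, which becomes w².
    A-cycle : A ≈ B + (w ^ 2 + w ^ 2) - (w + w)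
    A-cycle = begin
      A
        ≡⟨ ≡.cong (λ z → D (suc (suc z)) (symmetric x₃ f₃)) (ℕ.+-identityʳ h′) ⟨
      D (suc (suc (h′ +ℕ 0))) (symmetric x₃ f₃)
        ≈⟨ D-cycle u h′ 0 (path₃ h′) (λ d → trans (reflexive (≡.cong (λ z → f z d) a≡′)) (f-a d)) ⟩
      _ ≈⟨ +-cong (+-cong (+-cong (*-cong (trans (reflexive (≡.cong x a≡′)) x-a) tail₁) (-‿cong (*-congˡ tail₂)))
                          (-‿cong (trans (*-congˡ (D-zero _)) (*-identityʳ _))))
                  (-‿cong (trans (*-congˡ (D-zero _)) (*-identityʳ _))) ⟩
      (1# + (1# + 1#) * u ^ 2) * pathDet u h - u ^ 2 * pathDet u h′ - u ^ 2 * pathDet u h′ - (w + w)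
        ≈⟨ solve 4 (λ u K K′ w → (:1 :+ (:1 :+ :1) :* u :^ 2) :* K :- u :^ 2 :* K′ :- u :^ 2 :* K′ :- (w :+ w)
             := K :+ (u :^ 2 :* (K :- K′) :+ u :^ 2 :* (K :- K′)) :- (w :+ w)) refl u (pathDet u h) (pathDet u h′) w ⟩
      pathDet u h + (u ^ 2 * (pathDet u h - pathDet u h′) + u ^ 2 * (pathDet u h - pathDet u h′)) - (w + w)
        ≈⟨ +-congʳ (+-cong (sym B-path) (+-cong square square)) ⟩
      B + (w ^ 2 + w ^ 2) - (w + w) ∎
      where
      a≡′ : suc (suc (k′ +ℕ (l′ +ℕ 0))) ≡ a
      a≡′ = ≡.trans (≡.cong (λ z → suc (suc (k′ +ℕ z))) (ℕ.+-identityʳ l′)) (≡.sym a≡)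
      tail₁ : D (suc (h′ +ℕ 0)) (symmetric (x₃ ∘ suc) (f₃ ∘ suc)) ≈ pathDet u h
      tail₁ = trans (reflexive (≡.cong (λ z → D (suc z) (symmetric (x₃ ∘ suc) (f₃ ∘ suc))) (ℕ.+-identityʳ h′)))
        (D-path u h (path₃ h))
      tail₂ : D (h′ +ℕ 0) (symmetric (x₃ ∘ suc ∘ suc) (f₃ ∘ suc ∘ suc)) ≈ pathDet u h′
      tail₂ = trans (reflexive (≡.cong (λ z → D z (symmetric (x₃ ∘ suc ∘ suc) (f₃ ∘ suc ∘ suc))) (ℕ.+-identityʳ h′)))
        (D-path u h′ (IsPath-tail u {x = x₃ ∘ suc} {f₃ ∘ suc} (path₃ (suc h′))))
      square : u ^ 2 * (pathDet u h - pathDet u h′) ≈ w ^ 2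
      square = trans (*-congˡ (pathDet-difference u h′))
        (solve 2 (λ u p → u :^ 2 :* (u :* p) :^ 2 := (u :* (u :* p)) :^ 2) refl u (u ^ h′))

    α β L : Carrier
    α = 1# + w ^ 2 - (w + w)
    β = (w ^ 2 + w ^ 2) - (w + w)
    L = u ^ l

    A-α : A - u ^ 2 * B ≈ α
    A-α = begin
      A - u ^ 2 * B
        ≈⟨ +-congʳ A-cycle ⟩
      B + (w ^ 2 + w ^ 2) - (w + w) - u ^ 2 * B
        ≈⟨ solve 3 (λ u B w → B :+ (w :^ 2 :+ w :^ 2) :- (w :+ w) :- u :^ 2 :* B
             := (:1 :- u :^ 2) :* B :+ (w :^ 2 :+ w :^ 2) :- (w :+ w)) refl u B w ⟩
      (1# - u ^ 2) * B + (w ^ 2 + w ^ 2) - (w + w)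
        ≈⟨ +-congʳ (+-congʳ (trans (*-congˡ B-path) (pathDet-geometric u h))) ⟩
      1# - w ^ 2 + (w ^ 2 + w ^ 2) - (w + w)
        ≈⟨ solve 1 (λ w → :1 :- w :^ 2 :+ (w :^ 2 :+ w :^ 2) :- (w :+ w) := :1 :+ w :^ 2 :- (w :+ w)) refl w ⟩
      α ∎

    A-β : A - B ≈ β
    A-β = trans (+-congʳ A-cycle)
      (solve 2 (λ B w → B :+ (w :^ 2 :+ w :^ 2) :- (w :+ w) :- B := w :^ 2 :+ w :^ 2 :- (w :+ w)) refl B w)

    -- The joining path has only l - 1 interior vertices, so `X-chain` yields u^(2l-2). The missing
    -- u² is the coefficient of X - Y both in Pₖ = (1 + u²) X + u² (X - Y) and in the formula for (1
    -- - u²) X.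
    X-β : u ^ 2 * (X - Y) ≈ L ^ 2 * β
    X-β = trans (*-congˡ (trans (proj₂ X-chain) (*-congˡ A-β)))
      (solve 3 (λ u p b → u :^ 2 :* (p :^ 2 :* b) := (u :* p) :^ 2 :* b) refl u (u ^ l′) β)

    X-closed : (1# - u ^ 2) * X ≈ α - L ^ 2 * β
    X-closed = begin
      (1# - u ^ 2) * X
        ≈⟨ solve 3 (λ u X Y → (:1 :- u :^ 2) :* X := (X :- u :^ 2 :* Y) :- u :^ 2 :* (X :- Y)) refl u X Y ⟩
      (X - u ^ 2 * Y) - u ^ 2 * (X - Y)
        ≈⟨ +-cong (trans (proj₁ X-chain) A-α) (-‿cong X-β) ⟩
      α - L ^ 2 * β ∎

    Z-closed : (1# - u ^ 2) * Z ≈ (α - L ^ 2 * β) * (1# + v ^ 2 - (v + v)) + L ^ 2 * β * (1# - v ^ 2)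
    Z-closed = begin
      (1# - u ^ 2) * Z
        ≈⟨ *-congˡ Z-cycle ⟩
      (1# - u ^ 2) * ((1# + u ^ 2) * P - u ^ 2 * Q - u ^ 2 * K * X - (v + v) * X)
        -- Because (1 - u²)(1 + u²) = 1 - u⁴, the terms in P and Q combine into the two first
        -- integrals. In the remaining terms the factor 1 - u² is given to K, where it sums the
        -- geometric series, and to X.
        ≈⟨ solve 6 (λ u P Q K X v →
             (:1 :- u :^ 2) :* ((:1 :+ u :^ 2) :* P :- u :^ 2 :* Q :- u :^ 2 :* K :* X :- (v :+ v) :* X) :=
             (P :- u :^ 2 :* Q) :- u :^ 2 :* u :^ 2 :* (P :- Q) :- u :^ 2 :* ((:1 :- u :^ 2) :* K) :* X
               :- (v :+ v) :* ((:1 :- u :^ 2) :* X)) refl u P Q K X v ⟩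
      (P - u ^ 2 * Q) - u ^ 2 * u ^ 2 * (P - Q) - u ^ 2 * ((1# - u ^ 2) * K) * X - (v + v) * ((1# - u ^ 2) * X)
        ≈⟨ +-congʳ (+-cong (+-cong
             (trans (proj₁ P-chain) (+-congʳ Pₖ-vertex))
             (-‿cong (*-congˡ (trans (proj₂ P-chain) (*-congˡ (+-congʳ Pₖ-vertex))))))
             (-‿cong (*-congʳ (*-congˡ (pathDet-geometric u k′))))) ⟩
      ((1# + (1# + 1#) * u ^ 2) * X - u ^ 2 * Y - u ^ 2 * X)
        - u ^ 2 * u ^ 2 * ((u ^ k′) ^ 2 * ((1# + (1# + 1#) * u ^ 2) * X - u ^ 2 * Y - X))
        - u ^ 2 * (1# - (u ^ k) ^ 2) * X - (v + v) * ((1# - u ^ 2) * X)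
        -- With v = u² u^k′, the powers of u belonging to the first cycle combine into v, and X and
        -- Y occur only through (1 - u²) X and u² (X - Y), both already evaluated.
        ≈⟨ solve 4 (λ u p X Y → let v = u :* (u :* p) in
             ((:1 :+ (:1 :+ :1) :* u :^ 2) :* X :- u :^ 2 :* Y :- u :^ 2 :* X)
               :- u :^ 2 :* u :^ 2 :* (p :^ 2 :* ((:1 :+ (:1 :+ :1) :* u :^ 2) :* X :- u :^ 2 :* Y :- X))
               :- u :^ 2 :* (:1 :- (u :* p) :^ 2) :* X :- (v :+ v) :* ((:1 :- u :^ 2) :* X) :=
             (:1 :- u :^ 2) :* X :* (:1 :+ v :^ 2 :- (v :+ v)) :+ u :^ 2 :* (X :- Y) :* (:1 :- v :^ 2))
             refl u (u ^ k′) X Y ⟩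
      (1# - u ^ 2) * X * (1# + v ^ 2 - (v + v)) + u ^ 2 * (X - Y) * (1# - v ^ 2)
        ≈⟨ +-cong (*-congʳ X-closed) (*-congʳ X-β) ⟩
      (α - L ^ 2 * β) * (1# + v ^ 2 - (v + v)) + L ^ 2 * β * (1# - v ^ 2) ∎
      where K = pathDet u k′

  open Elimination

  N≡ : N ≡ suc (suc (k′ +ℕ suc r))
  N≡ = ≡.trans (ℕ.+-assoc k l (suc h)) (≡.trans
    (≡.cong (λ z → suc (k′ +ℕ suc z)) (ℕ.+-suc l′ h)) (≡.cong suc (ℕ.+-suc k′ (suc r))))

  det-closed : (1# - u ^ 2) * det R M ≈ (α - L ^ 2 * β) * (1# + v ^ 2 - (v + v)) + L ^ 2 * β * (1# - v ^ 2)
  det-closed = begin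
    (1# - u ^ 2) * det R M
      ≈⟨ *-congˡ (trans (det-cong entry) (sym (D≈det N (symmetric x f)))) ⟩
    (1# - u ^ 2) * D N (symmetric x f)
      ≡⟨ ≡.cong (λ z → (1# - u ^ 2) * D z (symmetric x f)) N≡ ⟩
    (1# - u ^ 2) * Z
      ≈⟨ Z-closed ⟩
    _ ∎

  -- Expansion of the closed form

  module _ where
    open Mult semiring using (_×_; ×-congʳ)

    private
      m n : ℕ
      m = suc k
      n = suc h

    ^-double : ∀ p → u ^ (2 *ℕ p) ≈ (u ^ p) ^ 2
    ^-double p = trans (^-congʳ u (ℕ.*-comm 2 p)) (sym (^-assocʳ u p 2))

    ^-product₂ : ∀ p q {y z} → u ^ p ≈ y → u ^ q ≈ z → u ^ (p +ℕ q) ≈ y * z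
    ^-product₂ p q p≈ q≈ = trans (^-homo-* u p q) (*-cong p≈ q≈)

    ^-product₃ : ∀ p q r {y z t} → u ^ p ≈ y → u ^ q ≈ z → u ^ r ≈ t → u ^ (p +ℕ q +ℕ r) ≈ y * z * t
    ^-product₃ p q r p≈ q≈ r≈ = ^-product₂ (p +ℕ q) r (^-product₂ p q p≈ q≈) r≈

    infixl 5 _⊞_ _⊟_

    _⊞_ : ∀ {y y′ z z′} → y ≈ y′ → z ≈ z′ → y + z ≈ y′ + z′
    _⊞_ = +-cong

    _⊟_ : ∀ {y y′ z z′} → y ≈ y′ → z ≈ z′ → y - z ≈ y′ - z′
    y≈ ⊟ z≈ = +-cong y≈ (-‿cong z≈)

    ζ⁻¹-handcuff : ∀ l>0 → ζ⁻¹ R (handcuff m n l m>2 n>2 l>0) u ≈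
        - (4 × (u ^ (2 *ℕ m +ℕ 2 *ℕ n +ℕ 2 *ℕ l)))
        + u ^ (2 *ℕ m +ℕ 2 *ℕ n)
        + 4 × (u ^ (2 *ℕ m +ℕ n +ℕ 2 *ℕ l))
        + 4 × (u ^ (m +ℕ 2 *ℕ n +ℕ 2 *ℕ l))
        - 2 × (u ^ (2 *ℕ m +ℕ n))
        - 2 × (u ^ (m +ℕ 2 *ℕ n))
        - 4 × (u ^ (m +ℕ n +ℕ 2 *ℕ l))
        + 4 × (u ^ (m +ℕ n))
        + u ^ (2 *ℕ n)
        + u ^ (2 *ℕ m)
        - 2 × (u ^ n)
        - 2 × (u ^ m)
        + 1#
    ζ⁻¹-handcuff l>0 = begin
      (1# - u ^ 2) ^ (rank ∸ 1) * det R M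
        ≈⟨ *-congʳ (trans (^-congʳ (1# - u ^ 2) (≡.cong (_∸ 1) rank≡2)) (*-identityʳ _)) ⟩
      (1# - u ^ 2) * det R M
        ≈⟨ det-closed ⟩
      (α - L ^ 2 * β) * (1# + v ^ 2 - (v + v)) + L ^ 2 * β * (1# - v ^ 2)
        -- Inserting α = (1 - w)² and β = -2w (1 - w), the left side factors as (1 - v)(1 - w) ((1 -
        -- v)(1 - w) - 4 v w L²), which is symmetric in the two cycles; the right side is its
        -- expansion.
        ≈⟨ solve 3 (λ v w L →
             let α = :1 :+ w :^ 2 :- (w :+ w)
                 β = (w :^ 2 :+ w :^ 2) :- (w :+ w)
             in (α :- L :^ 2 :* β) :* (:1 :+ v :^ 2 :- (v :+ v)) :+ L :^ 2 :* β :* (:1 :- v :^ 2) :=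
               :- (4 :× (v :^ 2 :* w :^ 2 :* L :^ 2))
               :+ v :^ 2 :* w :^ 2
               :+ 4 :× (v :^ 2 :* w :* L :^ 2)
               :+ 4 :× (v :* w :^ 2 :* L :^ 2)
               :- 2 :× (v :^ 2 :* w)
               :- 2 :× (v :* w :^ 2)
               :- 4 :× (v :* w :* L :^ 2)
               :+ 4 :× (v :* w)
               :+ w :^ 2
               :+ v :^ 2
               :- 2 :× w
               :- 2 :× v
               :+ :1) refl v w L ⟩
      _ ≈⟨ (-‿cong (×-congʳ 4 (^-product₃ (2 *ℕ m) (2 *ℕ n) (2 *ℕ l) v² w² L²))
           ⊞ ^-product₂ (2 *ℕ m) (2 *ℕ n) v² w²
           ⊞ ×-congʳ 4 (^-product₃ (2 *ℕ m) n (2 *ℕ l) v² refl L²)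
           ⊞ ×-congʳ 4 (^-product₃ m (2 *ℕ n) (2 *ℕ l) refl w² L²)
           ⊟ ×-congʳ 2 (^-product₂ (2 *ℕ m) n v² refl)
           ⊟ ×-congʳ 2 (^-product₂ m (2 *ℕ n) refl w²)
           ⊟ ×-congʳ 4 (^-product₃ m n (2 *ℕ l) refl refl L²)
           ⊞ ×-congʳ 4 (^-product₂ m n refl refl)
           ⊞ w² ⊞ v² ⊟ refl ⊟ refl ⊞ refl) ⟨
      _ ∎
      where
      v² = ^-double m
      w² = ^-double n
      L² = ^-double l

mainTheorem7 : ∀ {c ℓ} (R : CommutativeRing c ℓ) →
    let open CommutativeRing R
        open Exp semiring using (_^_)
        open Mult semiring using (_×_)
    in ∀ (m n l : ℕ) (m>2 : m > 2) (n>2 : n > 2) (l>0 : l > 0) (u : Carrier) →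
      ζ⁻¹ R (handcuff m n l m>2 n>2 l>0) u ≈
        - (4 × (u ^ (2 *ℕ m +ℕ 2 *ℕ n +ℕ 2 *ℕ l)))
        + u ^ (2 *ℕ m +ℕ 2 *ℕ n)
        + 4 × (u ^ (2 *ℕ m +ℕ n +ℕ 2 *ℕ l))
        + 4 × (u ^ (m +ℕ 2 *ℕ n +ℕ 2 *ℕ l))
        - 2 × (u ^ (2 *ℕ m +ℕ n))
        - 2 × (u ^ (m +ℕ 2 *ℕ n))
        - 4 × (u ^ (m +ℕ n +ℕ 2 *ℕ l))
        + 4 × (u ^ (m +ℕ n))
        + u ^ (2 *ℕ n)
        + u ^ (2 *ℕ m)
        - 2 × (u ^ n)
        - 2 × (u ^ m)
        + 1#
mainTheorem7 R (suc (suc k)) (suc (suc h)) (suc l) m>2@(s≤s (s≤s _)) n>2@(s≤s (s≤s _)) l>0@(s≤s _) u =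
  HandcuffDeterminant.ζ⁻¹-handcuff R k h l m>2 n>2 u l>0
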